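{- Let $r\geq 3$ and $k\geq 2$ be integers. For all positive integers $n$, $$\mathrm{ex}_L(n, C^r_{2k})\leq 64k^2r^{2r+3}\, n^{1+1/k}.$$
   Context: All hypergraphs are finite. An $r$-graph is an $r$-uniform hypergraph; it is linear if any two distinct edges share at most one vertex. The $r$-uniform linear cycle $C^r_\ell$ of length $\ell\ge3$ is the $r$-graph consisting of $\ell$ edges $e_1,\dots,e_\ell$ on $(r-1)\ell$ vertices such that $|e_i\cap e_j|=1$ if $j=i\pm 1$ (indices modulo $\ell$) and $|e_i\cap e_j|=0$ for all other $i\neq j$. For a linear $r$-graph $H$, the linear Turán number $\mathrm{ex}_L(n,H)$ is the maximum number of edges in an $n$-vertex linear $r$-graph that does not contain $H$ as a subgraph. -}

module Defs where

open import Data.Bool using (Bool; true; false)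
open import Data.Bool.Properties using () renaming (_≟_ to _≟ᵇ_)
open import Data.Empty using (⊥-elim)
open import Data.Fin as Fin using (Fin; zero; suc; toℕ; funToFin; finToFun)
import Data.Fin.Properties as Finₚ
open import Data.Fin.Subset using (Subset; _∈_; _∩_; ∣_∣)
open import Data.Fin.Subset.Properties using (anySubset?; _∈?_)
open import Data.List using (List; []; _∷_; length; lookup; tabulate)
open import Data.List.Membership.Propositional renaming (_∈_ to _∈ˡ_) using ()
open import Data.List.Membership.Propositional.Properties using (∈-lookup)
open import Data.List.Relation.Binary.Permutation.Propositional using (_↭_)
open import Data.List.Relation.Unary.All as All using (All; []; _∷_)
open import Data.List.Relation.Unary.AllPairs as AllPairs using ([]; _∷_)
open import Data.List.Relation.Unary.Unique.Propositional using (Unique)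
open import Data.List.Relation.Unary.Any using (here; there)
import Data.List.Membership.DecPropositional as DecMembership
open import Data.Nat using (ℕ; zero; suc; _*_; _∸_; _^_; _≤_; _≤?_; s≤s⁻¹; ∣_-_∣)
open import Data.Nat.Divisibility using (_∣_)
import Data.Nat.Properties as ℕₚ
open import Data.Product using (∃; ∃-syntax; Σ; _×_; _,_)
open import Data.Sum using (_⊎_; inj₁; inj₂)
open import Data.Vec as Vec using (Vec; []; _∷_)
import Data.Vec.Properties as Vecₚ
open import Function using (_∘_)
open import Function.Definitions using (Injective)
open import Relation.Binary.Definitions using (DecidableEquality)
open import Relation.Binary.PropositionalEquality
open import Relation.Nullary using (¬_; Dec; yes; no; does)
open import Relation.Nullary.Decidable using (map′; _×-dec_; _→-dec_; ¬?)
open import Relation.Unary using (Decidable)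

-- An r-uniform hypergraph on the vertex set Fin n.  The edge set is kept as
-- a duplicate-free list, so `length edges` is the number of edges; the order
-- of the list carries no meaning.
record RGraph (r n : ℕ) : Set where
  field
    edges   : List (Subset n)
    unique  : Unique edges
    uniform : All (λ e → ∣ e ∣ ≡ r) edges

  size : ℕ
  size = length edges

open RGraph public

Linear : ∀ {r n} → RGraph r n → Set
Linear G = ∀ e f → e ∈ˡ edges G → f ∈ˡ edges G → e ≢ f → ∣ e ∩ f ∣ ≤ 1

image : ∀ {m n} → (Fin m → Fin n) → Subset m → Subset n
image φ e = Vec.tabulate λ y → does (Finₚ.any? λ x → (x ∈? e) ×-dec (φ x Finₚ.≟ y))

-- G contains H as a (not necessarily induced) subgraph, up to renaming of
-- vertices.
Contains : ∀ {r m n} → RGraph r n → RGraph r m → Set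
Contains {m = m} {n} G H =
  Σ (Fin m → Fin n) λ φ →
    Injective _≡_ _≡_ φ × (∀ e → e ∈ˡ edges H → image φ e ∈ˡ edges G)

-- i + 1 ≡ j (mod ℓ)
Next : ∀ {ℓ} → Fin ℓ → Fin ℓ → Set
Next {ℓ} i j = ℓ ∣ ∣ suc (toℕ i) - toℕ j ∣

-- C is a copy of the r-uniform linear cycle of length ℓ.  The vertex count
-- (r ∸ 1) * ℓ is part of the type; for r ≥ 2 and ℓ ≥ 3 these conditions
-- determine C up to isomorphism.
IsLinearCycle : ∀ r ℓ → RGraph r ((r ∸ 1) * ℓ) → Set
IsLinearCycle r ℓ C =
  Σ (Fin ℓ → Subset ((r ∸ 1) * ℓ)) λ e →
    edges C ↭ tabulate e ×
    (∀ i j → i ≢ j → (Next i j ⊎ Next j i) → ∣ e i ∩ e j ∣ ≡ 1) ×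
    (∀ i j → i ≢ j → ¬ (Next i j ⊎ Next j i) → ∣ e i ∩ e j ∣ ≡ 0)

-- m is the number of edges of some H-free linear r-graph on n vertices.
Attained : ∀ {r h} → ℕ → RGraph r h → ℕ → Set
Attained {r} n H m = Σ (RGraph r n) λ G → Linear G × ¬ Contains G H × size G ≡ m

-- IsExL n H m  says  ex_L(n, H) = m.
IsExL : ∀ {r h} → ℕ → RGraph r h → ℕ → Set
IsExL n H m = Attained n H m × (∀ m′ → Attained n H m′ → m′ ≤ m)

-- The rest of the file shows that `IsExL n H` determines exactly one number
-- whenever H has an edge, i.e. that ex_L(n, H) is well defined.

isExL-unique : ∀ {r h n m m′} (H : RGraph r h) → IsExL n H m → IsExL n H m′ → m ≡ m′
isExL-unique H (a , max) (a′ , max′) = ℕₚ.≤-antisym (max′ _ a) (max _ a′)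

private
  _≟ˢ_ : ∀ {n} → DecidableEquality (Subset n)
  _≟ˢ_ = Vecₚ.≡-dec _≟ᵇ_

  unique? : ∀ {n} → Decidable (Unique {A = Subset n})
  unique? = AllPairs.allPairs? (λ x y → ¬? (x ≟ˢ y))

  anyVec? : ∀ {A : Set} → (∀ {P : A → Set} → Decidable P → Dec (∃ P)) →
            ∀ m {P : Vec A m → Set} → Decidable P → Dec (∃ P)
  anyVec? any zero P? = map′ (λ p → [] , p) (λ { ([] , p) → p }) (P? [])
  anyVec? any (suc m) P? =
    map′ (λ { (x , xs , p) → (x ∷ xs) , p }) (λ { ((x ∷ xs) , p) → x , xs , p })
      (any λ x → anyVec? any m λ xs → P? (x ∷ xs))

  all∈? : ∀ {A : Set} {P : A → Set} → Decidable P → (xs : List A) →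
          Dec (∀ x → x ∈ˡ xs → P x)
  all∈? P? xs = map′ (λ a _ → All.lookup a) (λ f → All.tabulate (f _)) (All.all? P? xs)

  image-cong : ∀ {m n} {φ ψ : Fin m → Fin n} → (∀ x → φ x ≡ ψ x) → ∀ e → image φ e ≡ image ψ e
  image-cong {φ = φ} {ψ} eq e = Vecₚ.tabulate-cong λ y → same y
    where
    same : ∀ y → does (Finₚ.any? λ x → (x ∈? e) ×-dec (φ x Finₚ.≟ y))
               ≡ does (Finₚ.any? λ x → (x ∈? e) ×-dec (ψ x Finₚ.≟ y))
    same y with Finₚ.any? (λ x → (x ∈? e) ×-dec (φ x Finₚ.≟ y))
              | Finₚ.any? (λ x → (x ∈? e) ×-dec (ψ x Finₚ.≟ y))
    ... | yes _ | yes _ = refl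
    ... | no _  | no _  = refl
    ... | yes (x , p , q) | no ¬p = ⊥-elim (¬p (x , p , trans (sym (eq x)) q))
    ... | no ¬p | yes (x , p , q) = ⊥-elim (¬p (x , p , trans (eq x) q))

  contains? : ∀ {r m n} (G : RGraph r n) (H : RGraph r m) → Dec (Contains G H)
  contains? {m = m} {n} G H =
    map′ (λ { (v , inj , im) → Vec.lookup v , (λ {x} {y} → inj x y) , im })
         (λ { (φ , inj , im) →
            let eq = Vecₚ.lookup∘tabulate φ in
            Vec.tabulate φ ,
            (λ x y p → inj (trans (sym (eq x)) (trans p (eq y)))) ,
            (λ e e∈ → subst (_∈ˡ edges G) (sym (image-cong eq e)) (im e e∈)) })
      (anyVec? Finₚ.any? m λ v →
        (Finₚ.all? λ x → Finₚ.all? λ y → (Vec.lookup v x Finₚ.≟ Vec.lookup v y) →-dec (x Finₚ.≟ y))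
        ×-dec all∈? (λ e → DecMembership._∈?_ _≟ˢ_ (image (Vec.lookup v) e) (edges G)) (edges H))

  linear? : ∀ {r n} (G : RGraph r n) → Dec (Linear G)
  linear? G = map′ (λ l e f e∈ f∈ → l e e∈ f f∈) (λ l e e∈ f f∈ → l e f e∈ f∈)
    (all∈? (λ e → all∈? (λ f → (¬? (e ≟ˢ f)) →-dec (∣ e ∩ f ∣ ≤? 1)) (edges G)) (edges G))

  good? : ∀ {r h n} (H : RGraph r h) (xs : List (Subset n)) →
          Dec (Σ (RGraph r n) λ G → edges G ≡ xs × Linear G × ¬ Contains G H)
  good? {r} H xs with unique? xs | All.all? (λ e → ∣ e ∣ ℕₚ.≟ r) xs
  ... | no ¬u | _     = no λ { (G , refl , _) → ¬u (unique G) }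
  ... | yes _ | no ¬s = no λ { (G , refl , _) → ¬s (uniform G) }
  ... | yes u | yes s =
    map′ (λ { (l , f) → G , refl , l , f })
         (λ { (G′ , refl , l , f) → l , f })
      (linear? G ×-dec ¬? (contains? G H))
    where G = record { edges = xs ; unique = u ; uniform = s }

  attained? : ∀ {r h} n (H : RGraph r h) → Decidable (Attained n H)
  attained? n H m =
    map′ (λ { (v , G , refl , l , f) → G , l , f , Vecₚ.length-toList v })
         (λ { (G , l , f , refl) → Vec.fromList (edges G) , G , sym (Vecₚ.toList∘fromList (edges G)) , l , f })
      (anyVec? anySubset? m λ v → good? H (Vec.toList v))

  bit : Bool → Fin 2
  bit false = zero
  bit true  = suc zero

  bit-injective : ∀ {a b} → bit a ≡ bit b → a ≡ b
  bit-injective {false} {false} _ = refl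
  bit-injective {true}  {true}  _ = refl

  code : ∀ {n} → Subset n → Fin (2 ^ n)
  code s = funToFin (bit ∘ Vec.lookup s)

  code-injective : ∀ {n} {s t : Subset n} → code s ≡ code t → s ≡ t
  code-injective {s = s} {t} eq = begin
    s                           ≡⟨ Vecₚ.tabulate∘lookup s ⟨
    Vec.tabulate (Vec.lookup s) ≡⟨ Vecₚ.tabulate-cong (λ x → bit-injective (bits x)) ⟩
    Vec.tabulate (Vec.lookup t) ≡⟨ Vecₚ.tabulate∘lookup t ⟩
    t                           ∎
    where
    open ≡-Reasoning
    bits : ∀ x → bit (Vec.lookup s x) ≡ bit (Vec.lookup t x)
    bits x = begin
      bit (Vec.lookup s x) ≡⟨ Finₚ.finToFun-funToFin (bit ∘ Vec.lookup s) x ⟨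
      finToFun (code s) x  ≡⟨ cong (λ c → finToFun c x) eq ⟩
      finToFun (code t) x  ≡⟨ Finₚ.finToFun-funToFin (bit ∘ Vec.lookup t) x ⟩
      bit (Vec.lookup t x) ∎

  lookup-injective : ∀ {A : Set} {xs : List A} → Unique xs → Injective _≡_ _≡_ (lookup xs)
  lookup-injective {xs = _ ∷ _}  _       {zero}  {zero}  _  = refl
  lookup-injective {xs = _ ∷ _}  (_ ∷ u) {suc _} {suc _} eq = cong suc (lookup-injective u eq)
  lookup-injective {xs = _ ∷ xs} (a ∷ _) {zero}  {suc j} eq =
    ⊥-elim (All.lookup a (∈-lookup {xs = xs} j) eq)
  lookup-injective {xs = _ ∷ xs} (a ∷ _) {suc i} {zero}  eq =
    ⊥-elim (All.lookup a (∈-lookup {xs = xs} i) (sym eq))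

  size≤2^n : ∀ {r n} (G : RGraph r n) → size G ≤ 2 ^ n
  size≤2^n G = Finₚ.injective⇒≤ {f = code ∘ lookup (edges G)}
    (lookup-injective (unique G) ∘ code-injective)

  greatest : ∀ {P : ℕ → Set} → Decidable P → P 0 → ∀ N → (∀ m → P m → m ≤ N) →
             ∃[ m ] (P m × (∀ m′ → P m′ → m′ ≤ m))
  greatest P? p0 zero bound = 0 , p0 , bound
  greatest P? p0 (suc N) bound with P? (suc N)
  ... | yes p = suc N , p , bound
  ... | no ¬p = greatest P? p0 N λ m p →
    s≤s⁻¹ (ℕₚ.≤∧≢⇒< (bound m p) λ { refl → ¬p p })

isExL-exists : ∀ {r h} n (H : RGraph r h) → edges H ≢ [] → ∃[ m ] IsExL n H m
isExL-exists {r} n H H≢∅ =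
  greatest (attained? n H) (∅ , (λ _ _ ()) , ∅-free (edges H) H≢∅ , refl) (2 ^ n)
    λ { m (G , _ , _ , refl) → size≤2^n G }
  where
  ∅ : RGraph r n
  ∅ = record { edges = [] ; unique = [] ; uniform = [] }
  ∅-free : ∀ es → es ≢ [] →
           ¬ Σ (Fin _ → Fin n) λ φ → Injective _≡_ _≡_ φ × (∀ e → e ∈ˡ es → image φ e ∈ˡ [])
  ∅-free []       es≢[] _            = es≢[] refl
  ∅-free (e ∷ es) _     (φ , _ , im) with () ← im e (here refl)

{-# OPTIONS --safe #-}

-- Pass to a subfamily of the edges in which every non-isolated vertex has degree at least
-- θ = ⌈ex / n⌉, and give each vertex u of its 2-shadow A the weight c u = Λ / deg u, so that
-- after division by Λ^(2k) the weighted count of closed 2k-walks is the trace of the 2k-th power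
-- of the simple random walk.  The steps of such a walk are hyperedges, and the walk fails to be a
-- linear cycle only if some vertex w is seen at two different steps (each step sees its hyperedge
-- minus the end point).  For a fixed pair of steps the weight of these closed walks is a pairing
-- Σ_w ⟨Z_w A^a , A^b Z′_w⟩ of marked kernels Z_w, Z′_w; by AM-GM and convexity in the distribution
-- of the factors A it is at most its value when all factors are on one side, where it is local
-- and at most r²/θ times the weight of the closed (2k-2)-walks.  Log-convexity of these traces,
-- with trace n at length 0 and at least 1 always, makes the ratio of consecutive traces at most
-- n^(1/k).  If no closed walk is a linear cycle, summing over the at most (2k)² pairs of steps
-- gives θ^k ≤ (16 k² r²)^k n.
module Submission where

open import Defs
open import Data.Bool using (true; false)
open import Data.Empty using (⊥; ⊥-elim)
open import Data.Fin as Fin using (Fin; zero; suc; toℕ; fromℕ; inject₁; combine; remQuot; punchOut)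
import Data.Fin.Properties as Finₚ
open import Data.Fin.Subset using (Subset; _∈_; _∩_; _-_; ∣_∣)
open import Data.Fin.Subset.Properties
  using (x∈p∧x≢y⇒x∈p-y; p─q⊆p; p─⊥≡p; x∈p∩q⁺; x∈p∩q⁻; ⊆-antisym; _∈?_)
open import Data.List as List using (List; []; _∷_; length; filter; tabulate)
open import Data.List.Membership.Propositional renaming (_∈_ to _∈ˡ_) using ()
open import Data.List.Membership.Propositional.Properties using (∈-tabulate⁺; ∈-tabulate⁻; ∈-lookup; ∈-filter⁻)
open import Data.List.Relation.Binary.Permutation.Propositional using (_↭_; ↭-sym)
open import Data.List.Relation.Binary.Permutation.Propositional.Properties using (∈-resp-↭)
open import Data.List.Relation.Unary.All as All using (All; []; _∷_)
open import Data.List.Relation.Unary.AllPairs using ([]; _∷_)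
open import Data.List.Relation.Unary.Unique.Propositional using (Unique)
open import Data.List.Relation.Unary.Unique.Propositional.Properties using (filter⁺)
open import Data.Nat as ℕ hiding (_≟_; ∣_-_∣)
open import Data.Nat.Divisibility using (_∣_; ∣-refl; ∣n⇒∣m*n; ∣m⇒∣m*n; ∣⇒≤; _∣0)
open import Data.Nat.DivMod using (m≡m%n+[m/n]*n; m%n<n; m/n*n≤m; m/n*n≡m)
open import Data.Nat.Properties
open import Data.Nat.Tactic.RingSolver using (solve-∀)
open import Data.Product using (∃-syntax; Σ; _×_; _,_; proj₁; proj₂; uncurry)
open import Data.Sum using (_⊎_; inj₁; inj₂; [_,_]′)
open import Data.Vec using (Vec; []; _∷_; lookup; _∷ʳ_; here; there)
open import Data.Vec.Properties using ([]=⇒lookup; lookup⇒[]=; lookup∘tabulate)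
open import Function using (_∘_; flip)
open import Function.Definitions using (Injective)
open import Relation.Binary.Definitions using (tri<; tri≈; tri>)
open import Relation.Binary.PropositionalEquality
open import Relation.Nullary using (¬_; Dec; yes; no; does)
open import Relation.Nullary.Decidable using (dec-true; _×-dec_; ¬?)
open import Algebra.Properties.Semiring.Sum +-*-semiring
  using (sum; sum-cong-≗; ∑-distrib-+; ∑-comm; *-distribˡ-sum; *-distribʳ-sum)

-- Finite sums and inequalities

-- The obstacle is that two steps seeing the same w may lie far apart on the closed walk, where no
-- local count of w is available. AM-GM replaces the pair by two copies of a single marked kernel;
-- once all factors A stand on one side of it, the two copies are neighbours on a closed walk and w
-- can be counted locally. Convexity reduces to that case only if both of its ends have the same
-- value, which transposition supplies for symmetric marks. Seeing w as a third vertex of the edge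
-- is symmetric, seeing it as the start of a step is not; the latter becomes symmetric by absorbing
-- an adjacent factor A. The four products of the two kinds of marks give the 4 in the constant, and
-- (2k)² is a crude count of pairs of steps. Degrees far above the minimum do no harm, since such a
-- vertex has a small weight: the local estimate needs only θ * c u ≤ Λ and deg u * c u ≤ Λ.
-- Everything stays in ℕ: Λ = n! makes the weights integral, and the final inequality is kept in its
-- k-th power.

sum-mono : ∀ {n} {f g : Fin n → ℕ} → (∀ i → f i ≤ g i) → sum f ≤ sum g
sum-mono {zero}  f≤g = z≤n
sum-mono {suc n} f≤g = +-mono-≤ (f≤g zero) (sum-mono (f≤g ∘ suc))

sum-zero : ∀ {n} {f : Fin n → ℕ} → (∀ i → f i ≡ 0) → sum f ≡ 0
sum-zero {zero}  f≡0 = refl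
sum-zero {suc n} f≡0 = cong₂ _+_ (f≡0 zero) (sum-zero (f≡0 ∘ suc))

term≤sum : ∀ {n} (f : Fin n → ℕ) i → f i ≤ sum f
term≤sum f zero    = m≤m+n _ _
term≤sum f (suc i) = ≤-trans (term≤sum (f ∘ suc) i) (m≤n+m _ (f zero))

sum-one : ∀ n → sum {n} (λ _ → 1) ≡ n
sum-one zero    = refl
sum-one (suc n) = cong suc (sum-one n)

sum-positive : ∀ {n} (f : Fin n → ℕ) → 0 < sum f → ∃[ i ] 0 < f i
sum-positive {suc n} f pos with f zero in eq
... | suc _ = zero , subst (0 <_) (sym eq) z<s
... | zero with sum-positive (f ∘ suc) pos
...   | i , p = suc i , p

sum-≤1 : ∀ {n} (f : Fin n → ℕ) → (∀ i → f i ≤ 1) →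
         (∀ i j → 0 < f i → 0 < f j → i ≡ j) → sum f ≤ 1
sum-≤1 {zero}  f f≤1 uniq = z≤n
sum-≤1 {suc n} f f≤1 uniq with f zero in eq
... | zero  = sum-≤1 (f ∘ suc) (f≤1 ∘ suc) λ i j p q → Finₚ.suc-injective (uniq (suc i) (suc j) p q)
... | suc m = subst (_≤ 1) (sym (trans (cong (suc m +_) (sum-zero rest)) (+-identityʳ (suc m))))
                (subst (_≤ 1) eq (f≤1 zero))
  where
  rest : ∀ i → f (suc i) ≡ 0
  rest i with f (suc i) in eq′
  ... | zero  = refl
  ... | suc _ with () ← uniq zero (suc i) (subst (0 <_) (sym eq) z<s) (subst (0 <_) (sym eq′) z<s)

δ : ∀ {n} → Fin n → Fin n → ℕ
δ x y with x Finₚ.≟ y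
... | yes _ = 1
... | no  _ = 0

δ-refl : ∀ {n} (x : Fin n) → δ x x ≡ 1
δ-refl x with x Finₚ.≟ x
... | yes _   = refl
... | no  x≢x = ⊥-elim (x≢x refl)

δ-≢ : ∀ {n} {x y : Fin n} → x ≢ y → δ x y ≡ 0
δ-≢ {x = x} {y} x≢y with x Finₚ.≟ y
... | yes x≡y = ⊥-elim (x≢y x≡y)
... | no  _   = refl

δ-sym : ∀ {n} (x y : Fin n) → δ x y ≡ δ y x
δ-sym x y with x Finₚ.≟ y
... | yes refl = sym (δ-refl x)
... | no  x≢y  = sym (δ-≢ (x≢y ∘ sym))

δ-replace : ∀ {n} (x y : Fin n) (f : Fin n → ℕ) → δ x y * f x ≡ δ x y * f y
δ-replace x y f with x Finₚ.≟ y
... | yes refl = refl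
... | no  _    = refl

sum-δ : ∀ {n} (w : Fin n) (f : Fin n → ℕ) → sum (λ t → δ t w * f t) ≡ f w
sum-δ {suc n} zero    f = trans (cong (1 * f zero +_) (sum-zero {n} λ _ → refl))
                            (trans (+-identityʳ _) (*-identityˡ _))
sum-δ {suc n} (suc w) f =
  trans (sum-cong-≗ {n} λ t → cong (_* f (suc t)) (δ-suc t)) (sum-δ w (f ∘ suc))
  where
  δ-suc : ∀ t → δ (suc t) (suc w) ≡ δ t w
  δ-suc t with t Finₚ.≟ w
  ... | yes _ = refl
  ... | no  _ = refl

am-gm : ∀ a b → 2 * (a * b) ≤ a * a + b * b
am-gm a b with ≤-total a b
... | inj₁ a≤b = subst (λ b → 2 * (a * b) ≤ a * a + b * b) (m+[n∸m]≡n a≤b) (below a (b ∸ a))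
  where
  below : ∀ a e → 2 * (a * (a + e)) ≤ a * a + (a + e) * (a + e)
  below a e = ≤-trans (m≤m+n _ (e * e)) (≤-reflexive (identity a e))
    where
    identity : ∀ a e → 2 * (a * (a + e)) + e * e ≡ a * a + (a + e) * (a + e)
    identity = solve-∀
... | inj₂ b≤a = subst (λ a → 2 * (a * b) ≤ a * a + b * b) (m+[n∸m]≡n b≤a) (above b (a ∸ b))
  where
  above : ∀ b e → 2 * ((b + e) * b) ≤ (b + e) * (b + e) + b * b
  above b e = ≤-trans (m≤m+n _ (e * e)) (≤-reflexive (identity b e))
    where
    identity : ∀ b e → 2 * ((b + e) * b) + e * e ≡ (b + e) * (b + e) + b * b
    identity = solve-∀

-- The free scalars `s` and `t` let `discriminant` recover Cauchy-Schwarz without square roots or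
-- subtraction.
weighted-am-gm : ∀ s t ω a b → 2 * (s * t) * (ω * (a * b)) ≤ s * s * (ω * (a * a)) + t * t * (ω * (b * b))
weighted-am-gm s t ω a b = begin
  2 * (s * t) * (ω * (a * b))                       ≡⟨ left s t ω a b ⟩
  ω * (2 * ((s * a) * (t * b)))                     ≤⟨ *-monoʳ-≤ ω (am-gm (s * a) (t * b)) ⟩
  ω * ((s * a) * (s * a) + (t * b) * (t * b))       ≡⟨ right s t ω a b ⟩
  s * s * (ω * (a * a)) + t * t * (ω * (b * b))     ∎
  where
  open ≤-Reasoning
  left : ∀ s t ω a b → 2 * (s * t) * (ω * (a * b)) ≡ ω * (2 * ((s * a) * (t * b)))
  left = solve-∀
  right : ∀ s t ω a b → ω * ((s * a) * (s * a) + (t * b) * (t * b)) ≡ s * s * (ω * (a * a)) + t * t * (ω * (b * b))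
  right = solve-∀

-- The discriminant argument: Z is a bilinear form evaluated at a pair with squares X and Y.
discriminant : ∀ X Y Z → (∀ s t → 2 * (s * t) * Z ≤ s * s * X + t * t * Y) → Z * Z ≤ X * Y
discriminant X zero zero h = z≤n
discriminant X zero (suc z) h = ⊥-elim (<⇒≱ bound (h 1 (suc X)))
  where
  Z = suc z
  open ≤-Reasoning
  identity₁ : ∀ X → 1 * 1 * X + suc X * suc X * 0 ≡ X
  identity₁ = solve-∀
  identity₂ : ∀ X z → suc X + (X + 1 + 2 * (z * suc X)) ≡ 2 * (1 * suc X) * suc z
  identity₂ = solve-∀
  bound : 1 * 1 * X + suc X * suc X * 0 < 2 * (1 * suc X) * suc z
  bound = begin-strict
    1 * 1 * X + suc X * suc X * 0    ≡⟨ identity₁ X ⟩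
    X                                <⟨ n<1+n X ⟩
    suc X                            ≤⟨ m≤m+n (suc X) _ ⟩
    suc X + (X + 1 + 2 * (z * suc X)) ≡⟨ identity₂ X z ⟩
    2 * (1 * suc X) * suc z          ∎
discriminant X Y@(suc _) Z h = *-cancelˡ-≤ Y (+-cancelˡ-≤ (Y * (Z * Z)) _ _ bound)
  where
  identity₁ : ∀ Y Z → Y * (Z * Z) + Y * (Z * Z) ≡ 2 * (Y * Z) * Z
  identity₁ = solve-∀
  identity₂ : ∀ X Y Z → Y * Y * X + Z * Z * Y ≡ Y * (Z * Z) + Y * (X * Y)
  identity₂ = solve-∀
  open ≤-Reasoning
  bound : Y * (Z * Z) + Y * (Z * Z) ≤ Y * (Z * Z) + Y * (X * Y)
  bound = begin
    Y * (Z * Z) + Y * (Z * Z) ≡⟨ identity₁ Y Z ⟩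
    2 * (Y * Z) * Z           ≤⟨ h Y Z ⟩
    Y * Y * X + Z * Z * Y     ≡⟨ identity₂ X Y Z ⟩
    Y * (Z * Z) + Y * (X * Y) ∎

cauchy-schwarz : ∀ {n} (ω f g : Fin n → ℕ) →
  sum (λ i → ω i * (f i * g i)) * sum (λ i → ω i * (f i * g i))
    ≤ sum (λ i → ω i * (f i * f i)) * sum (λ i → ω i * (g i * g i))
cauchy-schwarz {n} ω f g = discriminant _ _ _ λ s t → begin
  2 * (s * t) * sum fg                                      ≡⟨ *-distribˡ-sum (2 * (s * t)) fg ⟩
  sum (λ i → 2 * (s * t) * fg i)                            ≤⟨ sum-mono (λ i → weighted-am-gm s t (ω i) (f i) (g i)) ⟩
  sum (λ i → s * s * ff i + t * t * gg i)                   ≡⟨ ∑-distrib-+ (λ i → s * s * ff i) (λ i → t * t * gg i) ⟩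
  sum (λ i → s * s * ff i) + sum (λ i → t * t * gg i)
    ≡⟨ cong₂ _+_ (*-distribˡ-sum (s * s) ff) (*-distribˡ-sum (t * t) gg) ⟨
  s * s * sum ff + t * t * sum gg                           ∎
  where
  open ≤-Reasoning
  fg ff gg : Fin n → ℕ
  fg i = ω i * (f i * g i)
  ff i = ω i * (f i * f i)
  gg i = ω i * (g i * g i)

convex≤ends : ∀ B N (f : ℕ → ℕ) → (∀ i → 2 + i ≤ N → 2 * f (1 + i) ≤ f i + f (2 + i)) →
              f 0 ≤ B → f N ≤ B → ∀ i → i ≤ N → f i ≤ B
convex≤ends B N f conv f0≤B fN≤B zero    _ = f0≤B
convex≤ends B (suc N) f conv f0≤B fN≤B (suc i) (s≤s i≤N) with ≤-total (f 1) B
... | inj₁ f1≤B = convex≤ends B N (f ∘ suc) (λ j j≤ → conv (suc j) (s≤s j≤)) f1≤B fN≤B i i≤N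
... | inj₂ B≤f1 = ≤-trans (increasing i N i≤N ≤-refl) fN≤B
  where
  open ≤-Reasoning
  step : ∀ j → suc j ≤ suc N → f j ≤ f (suc j)
  step zero    _ = ≤-trans f0≤B B≤f1
  step (suc j) j≤ = +-cancelˡ-≤ (f (suc j)) _ _ (begin
    f (suc j) + f (suc j)        ≡⟨ cong (f (suc j) +_) (+-identityʳ (f (suc j))) ⟨
    2 * f (suc j)                ≤⟨ conv j j≤ ⟩
    f j + f (suc (suc j))        ≤⟨ +-monoˡ-≤ _ (step j (≤-trans (n≤1+n _) j≤)) ⟩
    f (suc j) + f (suc (suc j))  ∎)
  increasing : ∀ i m → i ≤ m → m ≤ N → f (suc i) ≤ f (suc m)
  increasing i m i≤m m≤N with m≤n⇒m<n∨m≡n i≤m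
  ... | inj₂ refl = ≤-refl
  increasing i (suc m) _ m≤N | inj₁ (s≤s i≤m) =
    ≤-trans (increasing i m i≤m (≤-trans (n≤1+n m) m≤N)) (step (suc m) (s≤s m≤N))

^-distribʳ-* : ∀ k m n → (m * n) ^ k ≡ m ^ k * n ^ k
^-distribʳ-* zero    m n = refl
^-distribʳ-* (suc k) m n = trans (cong (m * n *_) (^-distribʳ-* k m n)) (rearrange m n (m ^ k) (n ^ k))
  where
  rearrange : ∀ a b x y → a * b * (x * y) ≡ a * x * (b * y)
  rearrange = solve-∀

*-positive : ∀ m {n} → 0 < m * n → 0 < m × 0 < n
*-positive (suc m) {suc n} _ = z<s , z<s
*-positive (suc m) {zero}  p = ⊥-elim (n≮0 (subst (0 <_) (*-zeroʳ m) p))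

-- Kernels on a weighted vertex set

module Kernel {n : ℕ} (c : Fin n → ℕ) where

  Ker : Set
  Ker = Fin n → Fin n → ℕ

  infix 4 _≈_
  _≈_ : Ker → Ker → Set
  X ≈ Y = ∀ u v → X u v ≡ Y u v

  infixl 7 _∙_
  -- The matrix product `X D Y` with `D` the diagonal matrix of `c`. Keeping `D` in the product and
  -- out of the kernels leaves `A` symmetric, although for the weights used below `D A` is a
  -- multiple of the transition matrix of the random walk.
  _∙_ : Ker → Ker → Ker
  (X ∙ Y) u v = sum λ t → c t * (X u t * Y t v)

  infixl 6 _⊞_
  _⊞_ : Ker → Ker → Ker
  (X ⊞ Y) u v = X u v + Y u v

  ⟨_,_⟩ : Ker → Ker → ℕ
  ⟨ X , Y ⟩ = sum λ u → sum λ v → c u * c v * (X u v * Y u v)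

  ∥_∥² : Ker → ℕ
  ∥ X ∥² = ⟨ X , X ⟩

  tr : Ker → ℕ
  tr X = sum λ u → c u * X u u

  ≈-sym : ∀ {X Y} → X ≈ Y → Y ≈ X
  ≈-sym p u v = sym (p u v)

  ≈-trans : ∀ {X Y Z} → X ≈ Y → Y ≈ Z → X ≈ Z
  ≈-trans p q u v = trans (p u v) (q u v)

  ∙-cong : ∀ {X X′ Y Y′} → X ≈ X′ → Y ≈ Y′ → X ∙ Y ≈ X′ ∙ Y′
  ∙-cong p q u v = sum-cong-≗ λ t → cong (c t *_) (cong₂ _*_ (p u t) (q t v))

  ∙-congˡ : ∀ X {Y Y′} → Y ≈ Y′ → X ∙ Y ≈ X ∙ Y′
  ∙-congˡ X = ∙-cong {X} λ _ _ → refl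

  ∙-congʳ : ∀ Y {X X′} → X ≈ X′ → X ∙ Y ≈ X′ ∙ Y
  ∙-congʳ Y p = ∙-cong {Y = Y} p λ _ _ → refl

  ⟨⟩-cong : ∀ {X X′ Y Y′} → X ≈ X′ → Y ≈ Y′ → ⟨ X , Y ⟩ ≡ ⟨ X′ , Y′ ⟩
  ⟨⟩-cong p q = sum-cong-≗ λ u → sum-cong-≗ λ v → cong (c u * c v *_) (cong₂ _*_ (p u v) (q u v))

  tr-cong : ∀ {X Y} → X ≈ Y → tr X ≡ tr Y
  tr-cong p = sum-cong-≗ λ u → cong (c u *_) (p u u)

  ∙-distribˡ : ∀ X Y Z → X ∙ (Y ⊞ Z) ≈ X ∙ Y ⊞ X ∙ Z
  ∙-distribˡ X Y Z u v = trans (sum-cong-≗ λ t → expand (c t) (X u t) (Y t v) (Z t v))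
    (∑-distrib-+ (λ t → c t * (X u t * Y t v)) λ t → c t * (X u t * Z t v))
    where
    expand : ∀ a x y z → a * (x * (y + z)) ≡ a * (x * y) + a * (x * z)
    expand = solve-∀

  ∙-distribʳ : ∀ X Y Z → (X ⊞ Y) ∙ Z ≈ X ∙ Z ⊞ Y ∙ Z
  ∙-distribʳ X Y Z u v = trans (sum-cong-≗ λ t → expand (c t) (X u t) (Y u t) (Z t v))
    (∑-distrib-+ (λ t → c t * (X u t * Z t v)) λ t → c t * (Y u t * Z t v))
    where
    expand : ∀ a x y z → a * ((x + y) * z) ≡ a * (x * z) + a * (y * z)
    expand = solve-∀

  ⟨⟩-distribˡ : ∀ X Y Z → ⟨ X , Y ⊞ Z ⟩ ≡ ⟨ X , Y ⟩ + ⟨ X , Z ⟩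
  ⟨⟩-distribˡ X Y Z = trans
    (sum-cong-≗ λ u → trans (sum-cong-≗ λ v → expand (c u * c v) (X u v) (Y u v) (Z u v))
      (∑-distrib-+ (λ v → c u * c v * (X u v * Y u v)) λ v → c u * c v * (X u v * Z u v)))
    (∑-distrib-+ (λ u → sum λ v → c u * c v * (X u v * Y u v)) λ u → sum λ v → c u * c v * (X u v * Z u v))
    where
    expand : ∀ a x y z → a * (x * (y + z)) ≡ a * (x * y) + a * (x * z)
    expand = solve-∀

  ⟨⟩-sym : ∀ X Y → ⟨ X , Y ⟩ ≡ ⟨ Y , X ⟩
  ⟨⟩-sym X Y = sum-cong-≗ λ u → sum-cong-≗ λ v → cong (c u * c v *_) (*-comm (X u v) (Y u v))

  ⟨⟩-flip : ∀ X Y → ⟨ flip X , flip Y ⟩ ≡ ⟨ X , Y ⟩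
  ⟨⟩-flip X Y = trans (∑-comm λ u v → c u * c v * (X v u * Y v u))
    (sum-cong-≗ λ v → sum-cong-≗ λ u → cong (_* (X v u * Y v u)) (*-comm (c u) (c v)))

  tr-⊞ : ∀ X Y → tr (X ⊞ Y) ≡ tr X + tr Y
  tr-⊞ X Y = trans (sum-cong-≗ λ u → *-distribˡ-+ (c u) (X u u) (Y u u))
    (∑-distrib-+ (λ u → c u * X u u) λ u → c u * Y u u)

  tr-∙ : ∀ X Y → tr (X ∙ Y) ≡ ⟨ X , flip Y ⟩
  tr-∙ X Y = sum-cong-≗ λ u → trans (*-distribˡ-sum (c u) λ t → c t * (X u t * Y t u))
    (sum-cong-≗ λ t → sym (*-assoc (c u) (c t) _))

  tr-comm : ∀ X Y → tr (X ∙ Y) ≡ tr (Y ∙ X)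
  tr-comm X Y = begin
    tr (X ∙ Y)        ≡⟨ tr-∙ X Y ⟩
    ⟨ X , flip Y ⟩    ≡⟨ ⟨⟩-flip X (flip Y) ⟨
    ⟨ flip X , Y ⟩    ≡⟨ ⟨⟩-sym (flip X) Y ⟩
    ⟨ Y , flip X ⟩    ≡⟨ tr-∙ Y X ⟨
    tr (Y ∙ X)        ∎
    where open ≡-Reasoning

  ∙-flip : ∀ X Y → flip (X ∙ Y) ≈ flip Y ∙ flip X
  ∙-flip X Y u v = sum-cong-≗ λ t → cong (c t *_) (*-comm (X v t) (Y t u))

  ∙-assoc : ∀ X Y Z → (X ∙ Y) ∙ Z ≈ X ∙ (Y ∙ Z)
  ∙-assoc X Y Z u v = begin
    sum (λ t → c t * ((X ∙ Y) u t * Z t v))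
      ≡⟨ sum-cong-≗ (λ t → trans (cong (c t *_) (*-distribʳ-sum (Z t v) λ s → c s * (X u s * Y s t)))
                                 (*-distribˡ-sum (c t) λ s → c s * (X u s * Y s t) * Z t v)) ⟩
    sum (λ t → sum λ s → c t * (c s * (X u s * Y s t) * Z t v))
      ≡⟨ ∑-comm (λ t s → c t * (c s * (X u s * Y s t) * Z t v)) ⟩
    sum (λ s → sum λ t → c t * (c s * (X u s * Y s t) * Z t v))
      ≡⟨ sum-cong-≗ (λ s → sum-cong-≗ λ t → regroup (c t) (c s) (X u s) (Y s t) (Z t v)) ⟩
    sum (λ s → sum λ t → c s * (X u s * (c t * (Y s t * Z t v))))
      ≡⟨ sum-cong-≗ (λ s → trans (cong (c s *_) (*-distribˡ-sum (X u s) λ t → c t * (Y s t * Z t v)))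
                                 (*-distribˡ-sum (c s) λ t → X u s * (c t * (Y s t * Z t v)))) ⟨
    sum (λ s → c s * (X u s * (Y ∙ Z) s v)) ∎
    where
    open ≡-Reasoning
    regroup : ∀ a b x y z → a * (b * (x * y) * z) ≡ b * (x * (a * (y * z)))
    regroup = solve-∀

  ∙-adjoint : ∀ X Y Z → ⟨ X ∙ Y , Z ⟩ ≡ ⟨ Y , flip X ∙ Z ⟩
  ∙-adjoint X Y Z = begin
    ⟨ X ∙ Y , Z ⟩                  ≡⟨ tr-∙ (X ∙ Y) (flip Z) ⟨
    tr (X ∙ Y ∙ flip Z)            ≡⟨ tr-cong (∙-assoc X Y (flip Z)) ⟩
    tr (X ∙ (Y ∙ flip Z))          ≡⟨ tr-comm X (Y ∙ flip Z) ⟩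
    tr (Y ∙ flip Z ∙ X)            ≡⟨ tr-cong (∙-assoc Y (flip Z) X) ⟩
    tr (Y ∙ (flip Z ∙ X))          ≡⟨ tr-∙ Y (flip Z ∙ X) ⟩
    ⟨ Y , flip (flip Z ∙ X) ⟩      ≡⟨ ⟨⟩-cong {X = Y} (λ _ _ → refl) (∙-flip (flip Z) X) ⟩
    ⟨ Y , flip X ∙ Z ⟩             ∎
    where open ≡-Reasoning

  scaled-am-gm : ∀ X Y s t → 2 * (s * t) * ⟨ X , Y ⟩ ≤ s * s * ∥ X ∥² + t * t * ∥ Y ∥²
  scaled-am-gm X Y s t = begin
    2 * (s * t) * ⟨ X , Y ⟩
      ≡⟨ pull (2 * (s * t)) X Y ⟩
    sum (λ u → sum λ v → 2 * (s * t) * (c u * c v * (X u v * Y u v)))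
      ≤⟨ sum-mono (λ u → sum-mono λ v → weighted-am-gm s t (c u * c v) (X u v) (Y u v)) ⟩
    sum (λ u → sum λ v → s * s * (c u * c v * (X u v * X u v)) + t * t * (c u * c v * (Y u v * Y u v)))
      ≡⟨ sum-cong-≗ (λ u → ∑-distrib-+ (λ v → s * s * (c u * c v * (X u v * X u v))) λ v → t * t * (c u * c v * (Y u v * Y u v))) ⟩
    sum (λ u → sum (λ v → s * s * (c u * c v * (X u v * X u v))) + sum λ v → t * t * (c u * c v * (Y u v * Y u v)))
      ≡⟨ ∑-distrib-+ (λ u → sum λ v → s * s * (c u * c v * (X u v * X u v))) (λ u → sum λ v → t * t * (c u * c v * (Y u v * Y u v))) ⟩
    _
      ≡⟨ cong₂ _+_ (pull (s * s) X X) (pull (t * t) Y Y) ⟨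
    s * s * ∥ X ∥² + t * t * ∥ Y ∥² ∎
    where
    open ≤-Reasoning
    pull : ∀ k X Y → k * ⟨ X , Y ⟩ ≡ sum (λ u → sum λ v → k * (c u * c v * (X u v * Y u v)))
    pull k X Y = trans (*-distribˡ-sum k λ u → sum λ v → c u * c v * (X u v * Y u v))
      (sum-cong-≗ λ u → *-distribˡ-sum k λ v → c u * c v * (X u v * Y u v))

  ⟨⟩-am-gm : ∀ X Y → 2 * ⟨ X , Y ⟩ ≤ ∥ X ∥² + ∥ Y ∥²
  ⟨⟩-am-gm X Y = subst₂ _≤_ refl (cong₂ _+_ (*-identityˡ ∥ X ∥²) (*-identityˡ ∥ Y ∥²)) (scaled-am-gm X Y 1 1)

  ⟨⟩-cauchy-schwarz : ∀ X Y → ⟨ X , Y ⟩ * ⟨ X , Y ⟩ ≤ ∥ X ∥² * ∥ Y ∥²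
  ⟨⟩-cauchy-schwarz X Y = discriminant ∥ X ∥² ∥ Y ∥² ⟨ X , Y ⟩ (scaled-am-gm X Y)

  walks : ∀ N → (Vec (Fin n) N → ℕ) → ℕ
  walks zero    f = f []
  walks (suc N) f = sum λ t → c t * walks N λ xs → f (t ∷ xs)

  walks-mono : ∀ N {f g} → (∀ xs → f xs ≤ g xs) → walks N f ≤ walks N g
  walks-mono zero    f≤g = f≤g []
  walks-mono (suc N) f≤g = sum-mono λ t → *-monoʳ-≤ (c t) (walks-mono N λ xs → f≤g (t ∷ xs))

  walks-* : ∀ N k f → k * walks N f ≡ walks N λ xs → k * f xs
  walks-* zero    k f = refl
  walks-* (suc N) k f = trans (*-distribˡ-sum k λ t → c t * walks N λ xs → f (t ∷ xs))
    (sum-cong-≗ λ t → trans (swap k (c t) _) (cong (c t *_) (walks-* N k λ xs → f (t ∷ xs))))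
    where
    swap : ∀ a b x → a * (b * x) ≡ b * (a * x)
    swap = solve-∀

  walks-+ : ∀ N f g → walks N (λ xs → f xs + g xs) ≡ walks N f + walks N g
  walks-+ zero    f g = refl
  walks-+ (suc N) f g = trans
    (sum-cong-≗ λ t → trans (cong (c t *_) (walks-+ N (λ xs → f (t ∷ xs)) λ xs → g (t ∷ xs))) (*-distribˡ-+ (c t) _ _))
    (∑-distrib-+ (λ t → c t * walks N λ xs → f (t ∷ xs)) λ t → c t * walks N λ xs → g (t ∷ xs))

  walks-sum : ∀ N {m} (f : Fin m → Vec (Fin n) N → ℕ) →
              walks N (λ xs → sum λ i → f i xs) ≡ sum λ i → walks N (f i)
  walks-sum zero    f = refl
  walks-sum (suc N) f = trans
    (sum-cong-≗ λ t → trans (cong (c t *_) (walks-sum N λ i xs → f i (t ∷ xs)))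
                            (*-distribˡ-sum (c t) λ i → walks N λ xs → f i (t ∷ xs)))
    (∑-comm λ t i → c t * walks N λ xs → f i (t ∷ xs))

  walks-step : ∀ {N} {X Y X′ Y′ : Ker} {f g : Fin n → Vec (Fin n) N → Fin n → ℕ} →
               (∀ u v → X u v ≡ walks N λ xs → f u xs v) → (∀ u v → Y u v ≡ walks N λ xs → g u xs v) →
               ∀ u v → (X′ ∙ X ⊞ Y′ ∙ Y) u v
                       ≡ sum λ t → c t * walks N λ xs → X′ u t * f t xs v + Y′ u t * g t xs v
  walks-step {N} {X} {Y} {X′} {Y′} {f} {g} X≡ Y≡ u v = trans
    (sym (∑-distrib-+ (λ t → c t * (X′ u t * X t v)) λ t → c t * (Y′ u t * Y t v)))
    (sum-cong-≗ λ t → trans (sym (*-distribˡ-+ (c t) (X′ u t * X t v) (Y′ u t * Y t v))) (cong (c t *_) (trans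
      (cong₂ _+_ (trans (cong (X′ u t *_) (X≡ t v)) (walks-* N (X′ u t) λ xs → f t xs v))
                 (trans (cong (Y′ u t *_) (Y≡ t v)) (walks-* N (Y′ u t) λ xs → g t xs v)))
      (sym (walks-+ N (λ xs → X′ u t * f t xs v) λ xs → Y′ u t * g t xs v)))))

  module Power (A : Ker) (A-sym : ∀ u v → A u v ≡ A v u) where

    L^ R^ : ℕ → Ker → Ker
    L^ zero    X = X
    L^ (suc p) X = A ∙ L^ p X
    R^ zero    X = X
    R^ (suc q) X = R^ q X ∙ A

    L^-cong : ∀ p {X Y} → X ≈ Y → L^ p X ≈ L^ p Y
    L^-cong zero    e = e
    L^-cong (suc p) e = ∙-congˡ A (L^-cong p e)

    R^-cong : ∀ q {X Y} → X ≈ Y → R^ q X ≈ R^ q Y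
    R^-cong zero    e = e
    R^-cong (suc q) e = ∙-congʳ A (R^-cong q e)

    L^-shift : ∀ p X → L^ p (A ∙ X) ≈ L^ (suc p) X
    L^-shift zero    X = λ _ _ → refl
    L^-shift (suc p) X = ∙-congˡ A (L^-shift p X)

    R^-shift : ∀ q X → R^ q (X ∙ A) ≈ R^ (suc q) X
    R^-shift zero    X = λ _ _ → refl
    R^-shift (suc q) X = ∙-congʳ A (R^-shift q X)

    L^-+ : ∀ p p′ X → L^ p (L^ p′ X) ≈ L^ (p + p′) X
    L^-+ zero    p′ X = λ _ _ → refl
    L^-+ (suc p) p′ X = ∙-congˡ A (L^-+ p p′ X)

    R^-+ : ∀ q q′ X → R^ q (R^ q′ X) ≈ R^ (q + q′) X
    R^-+ zero    q′ X = λ _ _ → refl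
    R^-+ (suc q) q′ X = ∙-congʳ A (R^-+ q q′ X)

    L^-⊞ : ∀ p X Y → L^ p (X ⊞ Y) ≈ L^ p X ⊞ L^ p Y
    L^-⊞ zero    X Y = λ _ _ → refl
    L^-⊞ (suc p) X Y = ≈-trans (∙-congˡ A (L^-⊞ p X Y)) (∙-distribˡ A (L^ p X) (L^ p Y))

    R^-⊞ : ∀ q X Y → R^ q (X ⊞ Y) ≈ R^ q X ⊞ R^ q Y
    R^-⊞ zero    X Y = λ _ _ → refl
    R^-⊞ (suc q) X Y = ≈-trans (∙-congʳ A (R^-⊞ q X Y)) (∙-distribʳ (R^ q X) (R^ q Y) A)

    R^-∙ : ∀ q X Y → R^ q (X ∙ Y) ≈ X ∙ R^ q Y
    R^-∙ zero    X Y = λ _ _ → refl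
    R^-∙ (suc q) X Y = ≈-trans (∙-congʳ A (R^-∙ q X Y)) (∙-assoc X (R^ q Y) A)

    L^-∙ : ∀ p X Y → L^ p (X ∙ Y) ≈ L^ p X ∙ Y
    L^-∙ zero    X Y = λ _ _ → refl
    L^-∙ (suc p) X Y = ≈-trans (∙-congˡ A (L^-∙ p X Y)) (≈-sym (∙-assoc A (L^ p X) Y))

    R^L^-comm : ∀ q p X → R^ q (L^ p X) ≈ L^ p (R^ q X)
    R^L^-comm q zero    X = λ _ _ → refl
    R^L^-comm q (suc p) X = ≈-trans (R^-∙ q A (L^ p X)) (∙-congˡ A (R^L^-comm q p X))

    L^-flip : ∀ p X → flip (L^ p X) ≈ R^ p (flip X)
    L^-flip zero    X = λ _ _ → refl
    L^-flip (suc p) X = ≈-trans (∙-flip A (L^ p X)) (∙-cong (L^-flip p X) λ u v → A-sym v u)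

    R^-flip : ∀ q X → flip (R^ q X) ≈ L^ q (flip X)
    R^-flip zero    X = λ _ _ → refl
    R^-flip (suc q) X = ≈-trans (∙-flip (R^ q X) A) (∙-cong (λ u v → A-sym v u) (R^-flip q X))

    L^-adjoint : ∀ p X Y → ⟨ L^ p X , Y ⟩ ≡ ⟨ X , L^ p Y ⟩
    L^-adjoint zero    X Y = refl
    L^-adjoint (suc p) X Y = begin
      ⟨ A ∙ L^ p X , Y ⟩         ≡⟨ ∙-adjoint A (L^ p X) Y ⟩
      ⟨ L^ p X , flip A ∙ Y ⟩    ≡⟨ ⟨⟩-cong {X = L^ p X} (λ _ _ → refl) (∙-congʳ Y λ u v → A-sym v u) ⟩
      ⟨ L^ p X , A ∙ Y ⟩         ≡⟨ L^-adjoint p X (A ∙ Y) ⟩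
      ⟨ X , L^ p (A ∙ Y) ⟩       ≡⟨ ⟨⟩-cong {X = X} (λ _ _ → refl) (L^-shift p Y) ⟩
      ⟨ X , L^ (suc p) Y ⟩       ∎
      where open ≡-Reasoning

    R^-adjoint : ∀ q X Y → ⟨ R^ q X , Y ⟩ ≡ ⟨ X , R^ q Y ⟩
    R^-adjoint q X Y = begin
      ⟨ R^ q X , Y ⟩                        ≡⟨ ⟨⟩-flip (R^ q X) Y ⟨
      ⟨ flip (R^ q X) , flip Y ⟩            ≡⟨ ⟨⟩-cong {Y = flip Y} (R^-flip q X) (λ _ _ → refl) ⟩
      ⟨ L^ q (flip X) , flip Y ⟩            ≡⟨ L^-adjoint q (flip X) (flip Y) ⟩
      ⟨ flip X , L^ q (flip Y) ⟩            ≡⟨ ⟨⟩-cong {X = flip X} (λ _ _ → refl) (≈-sym (R^-flip q Y)) ⟩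
      ⟨ flip X , flip (R^ q Y) ⟩            ≡⟨ ⟨⟩-flip X (R^ q Y) ⟩
      ⟨ X , R^ q Y ⟩                        ∎
      where open ≡-Reasoning

-- Distribution of the factors `A` around marked kernels

module Pairings {n : ℕ} (c : Fin n → ℕ) (A : Fin n → Fin n → ℕ) (A-sym : ∀ u v → A u v ≡ A v u) where
    open Kernel c
    open Power A A-sym

    -- Multiplication by the symmetric `A` is self-adjoint on either side, so factors cross the
    -- pairing freely and only their total numbers on the left and on the right matter.
    regroup : ∀ p p′ q q′ P P′ Q Q′ X Y → p + p′ ≡ P + P′ → q + q′ ≡ Q + Q′ →
              ⟨ L^ p (R^ q X) , L^ p′ (R^ q′ Y) ⟩ ≡ ⟨ L^ P (R^ Q X) , L^ P′ (R^ Q′ Y) ⟩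
    regroup p p′ q q′ P P′ Q Q′ X Y eq eq′ =
      trans (collect p p′ q q′)
        (trans (cong₂ (λ i j → ⟨ X , L^ i (R^ j Y) ⟩) eq eq′) (sym (collect P P′ Q Q′)))
      where
      open ≡-Reasoning
      collect : ∀ p p′ q q′ → ⟨ L^ p (R^ q X) , L^ p′ (R^ q′ Y) ⟩ ≡ ⟨ X , L^ (p + p′) (R^ (q + q′) Y) ⟩
      collect p p′ q q′ = begin
        ⟨ L^ p (R^ q X) , L^ p′ (R^ q′ Y) ⟩        ≡⟨ L^-adjoint p (R^ q X) (L^ p′ (R^ q′ Y)) ⟩
        ⟨ R^ q X , L^ p (L^ p′ (R^ q′ Y)) ⟩        ≡⟨ ⟨⟩-cong {X = R^ q X} (λ _ _ → refl) (L^-+ p p′ (R^ q′ Y)) ⟩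
        ⟨ R^ q X , L^ (p + p′) (R^ q′ Y) ⟩         ≡⟨ R^-adjoint q X (L^ (p + p′) (R^ q′ Y)) ⟩
        ⟨ X , R^ q (L^ (p + p′) (R^ q′ Y)) ⟩
          ≡⟨ ⟨⟩-cong {X = X} (λ _ _ → refl)
               (≈-trans (R^L^-comm q (p + p′) (R^ q′ Y)) (L^-cong (p + p′) (R^-+ q q′ Y))) ⟩
        ⟨ X , L^ (p + p′) (R^ (q + q′) Y) ⟩        ∎

    energy : (Fin n → Ker) → ℕ → ℕ → ℕ
    energy Z p q = sum λ w → ∥ L^ p (R^ q (Z w)) ∥²

    -- Passing one left factor to the second copy of the kernel and one right factor to the first
    -- turns the middle norm into the inner product of the two outer kernels; AM-GM does the rest.
    energy-convex : ∀ Z p q → 2 * energy Z (1 + p) (1 + q) ≤ energy Z p (2 + q) + energy Z (2 + p) q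
    energy-convex Z p q = begin
      2 * energy Z (1 + p) (1 + q)
        ≡⟨ *-distribˡ-sum 2 (λ w → ∥ L^ (1 + p) (R^ (1 + q) (Z w)) ∥²) ⟩
      sum (λ w → 2 * ∥ L^ (1 + p) (R^ (1 + q) (Z w)) ∥²)
        ≡⟨ sum-cong-≗ (λ w → cong (2 *_) (regroup (1 + p) (1 + p) (1 + q) (1 + q) p (2 + p) (2 + q) q (Z w) (Z w) (shift p) (shift′ q))) ⟩
      sum (λ w → 2 * ⟨ L^ p (R^ (2 + q) (Z w)) , L^ (2 + p) (R^ q (Z w)) ⟩)
        ≤⟨ sum-mono (λ w → ⟨⟩-am-gm (L^ p (R^ (2 + q) (Z w))) (L^ (2 + p) (R^ q (Z w)))) ⟩
      sum (λ w → ∥ L^ p (R^ (2 + q) (Z w)) ∥² + ∥ L^ (2 + p) (R^ q (Z w)) ∥²)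
        ≡⟨ ∑-distrib-+ (λ w → ∥ L^ p (R^ (2 + q) (Z w)) ∥²) (λ w → ∥ L^ (2 + p) (R^ q (Z w)) ∥²) ⟩
      energy Z p (2 + q) + energy Z (2 + p) q ∎
      where
      open ≤-Reasoning
      shift : ∀ p → (1 + p) + (1 + p) ≡ p + (2 + p)
      shift = solve-∀
      shift′ : ∀ q → (1 + q) + (1 + q) ≡ (2 + q) + q
      shift′ = solve-∀

    energy-flip : ∀ Z → (∀ w → flip (Z w) ≈ Z w) → ∀ p → energy Z p 0 ≡ energy Z 0 p
    energy-flip Z Z-sym p = sum-cong-≗ λ w → begin
      ∥ L^ p (Z w) ∥²             ≡⟨ ⟨⟩-flip (L^ p (Z w)) (L^ p (Z w)) ⟨
      ∥ flip (L^ p (Z w)) ∥²      ≡⟨ ⟨⟩-cong (flipped w) (flipped w) ⟩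
      ∥ R^ p (Z w) ∥²             ∎
      where
      open ≡-Reasoning
      flipped : ∀ w → flip (L^ p (Z w)) ≈ R^ p (Z w)
      flipped w = ≈-trans (L^-flip p (Z w)) (R^-cong p (Z-sym w))

    Bounded : ℕ → ℕ → ℕ → (Fin n → Ker) → Set
    Bounded θ B s Z = ∀ p q → p + q ≡ s → θ * energy Z p q ≤ B

    -- Convexity in `p` leaves only the two ends to check, and for symmetric `Z` transposition makes
    -- these equal, so the end with all factors on the right suffices.
    bounded : ∀ θ B s Z → (∀ w → flip (Z w) ≈ Z w) → θ * energy Z 0 s ≤ B → Bounded θ B s Z
    bounded θ B s Z Z-sym end p q refl =
      subst (λ q → θ * energy Z p q ≤ B) (m+n∸m≡n p q)
        (convex≤ends B (p + q) f convex end
          (subst (_≤ B) (sym (cong (θ *_) (trans (cong (energy Z (p + q)) (n∸n≡0 (p + q))) (energy-flip Z Z-sym (p + q))))) end)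
          p (m≤m+n p q))
      where
      f : ℕ → ℕ
      f i = θ * energy Z i (p + q ∸ i)
      convex : ∀ i → 2 + i ≤ p + q → 2 * f (1 + i) ≤ f i + f (2 + i)
      convex i 2+i≤s = subst (λ s → 2 * (θ * energy Z (1 + i) (s ∸ (1 + i))) ≤ θ * energy Z i (s ∸ i) + θ * energy Z (2 + i) (s ∸ (2 + i)))
                         (m+[n∸m]≡n 2+i≤s) (shifted (p + q ∸ (2 + i)))
        where
        open ≤-Reasoning
        scale : ∀ θ x → 2 * (θ * x) ≡ θ * (2 * x)
        scale = solve-∀
        shifted : ∀ e → 2 * (θ * energy Z (1 + i) (2 + i + e ∸ (1 + i)))
                      ≤ θ * energy Z i (2 + i + e ∸ i) + θ * energy Z (2 + i) (2 + i + e ∸ (2 + i))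
        shifted e = begin
          2 * (θ * energy Z (1 + i) (2 + i + e ∸ (1 + i)))
            ≡⟨ cong (λ j → 2 * (θ * energy Z (1 + i) j)) (trans (cong (_∸ (1 + i)) (sym (+-suc (1 + i) e))) (m+n∸m≡n (1 + i) (1 + e))) ⟩
          2 * (θ * energy Z (1 + i) (1 + e))
            ≡⟨ scale θ (energy Z (1 + i) (1 + e)) ⟩
          θ * (2 * energy Z (1 + i) (1 + e))
            ≤⟨ *-monoʳ-≤ θ (energy-convex Z i e) ⟩
          θ * (energy Z i (2 + e) + energy Z (2 + i) e)
            ≡⟨ *-distribˡ-+ θ (energy Z i (2 + e)) (energy Z (2 + i) e) ⟩
          θ * energy Z i (2 + e) + θ * energy Z (2 + i) e
            ≡⟨ cong₂ (λ j l → θ * energy Z i j + θ * energy Z (2 + i) l)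
                 (sym (trans (cong (_∸ i) (trans (cong suc (sym (+-suc i e))) (sym (+-suc i (1 + e))))) (m+n∸m≡n i (2 + e))))
                 (sym (m+n∸m≡n (2 + i) e)) ⟩
          θ * energy Z i (2 + i + e ∸ i) + θ * energy Z (2 + i) (2 + i + e ∸ (2 + i)) ∎

    -- AM-GM separates the two marks: each is paired with itself and keeps the share of the factors
    -- assigned to it.
    pairing-split : ∀ θ B {s s′} Z Z′ → Bounded θ B s Z → Bounded θ B s′ Z′ →
                    ∀ p p′ q q′ → p + q ≡ s → p′ + q′ ≡ s′ →
                    θ * sum (λ w → ⟨ R^ (q + q′) (Z w) , L^ (p + p′) (Z′ w) ⟩) ≤ B
    pairing-split θ B Z Z′ bd bd′ p p′ q q′ p+q≡s p′+q′≡s′ = *-cancelˡ-≤ 2 (begin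
      2 * (θ * sum (λ w → ⟨ R^ (q + q′) (Z w) , L^ (p + p′) (Z′ w) ⟩))
        ≡⟨ cong (λ x → 2 * (θ * x)) (sum-cong-≗ λ w →
             regroup 0 (p + p′) (q + q′) 0 p p′ q q′ (Z w) (Z′ w) refl (+-identityʳ (q + q′))) ⟩
      2 * (θ * sum inner)
        ≡⟨ scale θ (sum inner) ⟩
      θ * (2 * sum inner)
        ≡⟨ cong (θ *_) (*-distribˡ-sum 2 inner) ⟩
      θ * sum (λ w → 2 * inner w)
        ≤⟨ *-monoʳ-≤ θ (sum-mono λ w → ⟨⟩-am-gm (L^ p (R^ q (Z w))) (L^ p′ (R^ q′ (Z′ w)))) ⟩
      θ * sum (λ w → ∥ L^ p (R^ q (Z w)) ∥² + ∥ L^ p′ (R^ q′ (Z′ w)) ∥²)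
        ≡⟨ cong (θ *_) (∑-distrib-+ (λ w → ∥ L^ p (R^ q (Z w)) ∥²) λ w → ∥ L^ p′ (R^ q′ (Z′ w)) ∥²) ⟩
      θ * (energy Z p q + energy Z′ p′ q′)
        ≡⟨ *-distribˡ-+ θ (energy Z p q) (energy Z′ p′ q′) ⟩
      θ * energy Z p q + θ * energy Z′ p′ q′
        ≤⟨ +-mono-≤ (bd p q p+q≡s) (bd′ p′ q′ p′+q′≡s′) ⟩
      B + B
        ≡⟨ cong (B +_) (+-identityʳ B) ⟨
      2 * B ∎)
      where
      open ≤-Reasoning
      inner : Fin n → ℕ
      inner w = ⟨ L^ p (R^ q (Z w)) , L^ p′ (R^ q′ (Z′ w)) ⟩
      scale : ∀ θ x → 2 * (θ * x) ≡ θ * (2 * x)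
      scale = solve-∀

    -- `Z` must receive exactly `s` factors. If `a ≤ s` it takes all right factors and fills up with
    -- left ones; otherwise it takes `s` right factors and leaves the surplus to `Z′`.
    pairing≤ : ∀ θ B {s s′} Z Z′ → Bounded θ B s Z → Bounded θ B s′ Z′ → ∀ a b → a + b ≡ s + s′ →
               θ * sum (λ w → ⟨ R^ a (Z w) , L^ b (Z′ w) ⟩) ≤ B
    pairing≤ θ B {s} {s′} Z Z′ bd bd′ a b a+b≡s+s′ with ≤-total a s
    ... | inj₁ a≤s = subst₂ (λ a b → θ * sum (λ w → ⟨ R^ a (Z w) , L^ b (Z′ w) ⟩) ≤ B) (+-identityʳ a) b≡
                       (pairing-split θ B Z Z′ bd bd′ (s ∸ a) s′ a 0 (m∸n+n≡m a≤s) (+-identityʳ s′))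
      where
      b≡ : s ∸ a + s′ ≡ b
      b≡ = +-cancelˡ-≡ a _ _
        (trans (sym (+-assoc a (s ∸ a) s′)) (trans (cong (_+ s′) (m+[n∸m]≡n a≤s)) (sym a+b≡s+s′)))
    ... | inj₂ s≤a = subst (λ a → θ * sum (λ w → ⟨ R^ a (Z w) , L^ b (Z′ w) ⟩) ≤ B) (m+[n∸m]≡n s≤a)
                       (pairing-split θ B Z Z′ bd bd′ 0 b s (a ∸ s) refl s′≡)
      where
      s′≡ : b + (a ∸ s) ≡ s′
      s′≡ = +-cancelˡ-≡ s _ _ (begin
        s + (b + (a ∸ s))   ≡⟨ cong (s +_) (+-comm b (a ∸ s)) ⟩
        s + (a ∸ s + b)     ≡⟨ +-assoc s (a ∸ s) b ⟨
        s + (a ∸ s) + b     ≡⟨ cong (_+ b) (m+[n∸m]≡n s≤a) ⟩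
        a + b               ≡⟨ a+b≡s+s′ ⟩
        s + s′              ∎)
        where open ≡-Reasoning

    -- `pow m` has `m + 1` factors `A`, so `closed m` is the weight of the closed walks of `2m + 2`
    -- steps. Counting starts at one factor because the unit of `∙` would be the diagonal kernel
    -- with entries `1 / c u`, in general not integral.
    pow : ℕ → Ker
    pow m = L^ m A

    closed : ℕ → ℕ
    closed m = ∥ pow m ∥²

    R^-pow : ∀ m → R^ m A ≈ pow m
    R^-pow zero    = λ _ _ → refl
    R^-pow (suc m) = ≈-trans (∙-congʳ A (R^-pow m)) (≈-trans (≈-sym (L^-∙ m A A)) (L^-shift m A))

    pow-sym : ∀ m → flip (pow m) ≈ pow m
    pow-sym m = ≈-trans (L^-flip m A) (≈-trans (R^-cong m λ u v → A-sym v u) (R^-pow m))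

    tr-pow : ∀ m → tr (pow (m + suc m)) ≡ closed m
    tr-pow m = begin
      tr (pow (m + suc m))            ≡⟨ tr-cong (L^-+ m (suc m) A) ⟨
      tr (L^ m (A ∙ pow m))           ≡⟨ tr-cong (L^-∙ m A (pow m)) ⟩
      tr (pow m ∙ pow m)              ≡⟨ tr-∙ (pow m) (pow m) ⟩
      ⟨ pow m , flip (pow m) ⟩        ≡⟨ ⟨⟩-cong {X = pow m} (λ _ _ → refl) (pow-sym m) ⟩
      closed m                        ∎
      where open ≡-Reasoning

    -- Walks with marked steps

    module Marks (σ : Fin n → Ker) where

      -- The coefficients of `z` and `z²` in the product of `N + 1` factors `A + z σ w`, developed
      -- along the first factor.
      one-mark two-marks : Fin n → ℕ → Ker
      one-mark  w zero    = σ w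
      one-mark  w (suc N) = A ∙ one-mark w N ⊞ σ w ∙ pow N
      two-marks w zero    = λ _ _ → 0
      two-marks w (suc N) = A ∙ two-marks w N ⊞ σ w ∙ one-mark w N

      walk : ∀ {N} → Fin n → Vec (Fin n) N → Fin n → ℕ
      walk u []       v = A u v
      walk u (x ∷ xs) v = A u x * walk x xs v

      walk₁ walk₂ : ∀ {N} → Fin n → Fin n → Vec (Fin n) N → Fin n → ℕ
      walk₁ w u []       v = σ w u v
      walk₁ w u (x ∷ xs) v = A u x * walk₁ w x xs v + σ w u x * walk x xs v
      walk₂ w u []       v = 0
      walk₂ w u (x ∷ xs) v = A u x * walk₂ w x xs v + σ w u x * walk₁ w x xs v

      pow-walks : ∀ N u v → pow N u v ≡ walks N λ xs → walk u xs v
      pow-walks zero    u v = refl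
      pow-walks (suc N) u v = sum-cong-≗ λ t → cong (c t *_)
        (trans (cong (A u t *_) (pow-walks N t v)) (walks-* N (A u t) λ xs → walk t xs v))

      one-mark-walks : ∀ w N u v → one-mark w N u v ≡ walks N λ xs → walk₁ w u xs v
      one-mark-walks w zero    u v = refl
      one-mark-walks w (suc N) u v = walks-step {N} {X′ = A} {Y′ = σ w} {walk₁ w} {walk} (one-mark-walks w N) (pow-walks N) u v

      two-marks-walks : ∀ w N u v → two-marks w N u v ≡ walks N λ xs → walk₂ w u xs v
      two-marks-walks w zero    u v = refl
      two-marks-walks w (suc N) u v = walks-step {N} {X′ = A} {Y′ = σ w} {walk₂ w} {walk₁ w} (two-marks-walks w N) (one-mark-walks w N) u v

      -- Both sides sum over the same vertex sequences with the same weights, so they can be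
      -- compared walk by walk. In the application the hypothesis says that every closed walk has a
      -- conflict.
      tr-pow≤two-marks : ∀ N → (∀ u (xs : Vec (Fin n) N) → walk u xs u ≤ sum λ w → walk₂ w u xs u) →
                         tr (pow N) ≤ sum λ w → tr (two-marks w N)
      tr-pow≤two-marks N walk≤ = begin
        sum (λ u → c u * pow N u u)
          ≡⟨ sum-cong-≗ (λ u → cong (c u *_) (pow-walks N u u)) ⟩
        sum (λ u → c u * walks N λ xs → walk u xs u)
          ≤⟨ sum-mono (λ u → *-monoʳ-≤ (c u) (walks-mono N (walk≤ u))) ⟩
        sum (λ u → c u * walks N λ xs → sum λ w → walk₂ w u xs u)
          ≡⟨ sum-cong-≗ (λ u → trans (cong (c u *_) (walks-sum N λ w xs → walk₂ w u xs u))
               (*-distribˡ-sum (c u) λ w → walks N λ xs → walk₂ w u xs u)) ⟩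
        sum (λ u → sum λ w → c u * walks N λ xs → walk₂ w u xs u)
          ≡⟨ sum-cong-≗ (λ u → sum-cong-≗ λ w → cong (c u *_) (two-marks-walks w N u u)) ⟨
        sum (λ u → sum λ w → c u * two-marks w N u u)
          ≡⟨ ∑-comm (λ u w → c u * two-marks w N u u) ⟩
        sum (λ w → tr (two-marks w N)) ∎
        where open ≤-Reasoning

      walk-step : ∀ {N} u (xs : Vec (Fin n) N) v → 0 < walk u xs v → ∀ i → 0 < A (lookup (u ∷ xs) i) (lookup (xs ∷ʳ v) i)
      walk-step u []       v pos zero    = pos
      walk-step u (x ∷ xs) v pos zero    = proj₁ (*-positive (A u x) pos)
      walk-step u (x ∷ xs) v pos (suc i) = walk-step x xs v (proj₂ (*-positive (A u x) pos)) i

      walk₁-positive : ∀ {N} w u (xs : Vec (Fin n) N) v → 0 < walk u xs v →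
                       ∀ j → 0 < σ w (lookup (u ∷ xs) j) (lookup (xs ∷ʳ v) j) → 0 < walk₁ w u xs v
      walk₁-positive w u []       v pos zero    σ>0 = σ>0
      walk₁-positive w u (x ∷ xs) v pos zero    σ>0 = ≤-trans (*-mono-< σ>0 (proj₂ (*-positive (A u x) pos))) (m≤n+m _ _)
      walk₁-positive w u (x ∷ xs) v pos (suc j) σ>0 with *-positive (A u x) pos
      ... | A>0 , rest = ≤-trans (*-mono-< A>0 (walk₁-positive w x xs v rest j σ>0)) (m≤m+n _ _)

      walk₂-positive : ∀ {N} w u (xs : Vec (Fin n) N) v → 0 < walk u xs v →
                       ∀ i j → i Fin.< j → 0 < σ w (lookup (u ∷ xs) i) (lookup (xs ∷ʳ v) i) →
                       0 < σ w (lookup (u ∷ xs) j) (lookup (xs ∷ʳ v) j) → 0 < walk₂ w u xs v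
      walk₂-positive w u (x ∷ xs) v pos zero    (suc j) _         σ>0 σ>0′ =
        ≤-trans (*-mono-< σ>0 (walk₁-positive w x xs v (proj₂ (*-positive (A u x) pos)) j σ>0′)) (m≤n+m _ _)
      walk₂-positive w u (x ∷ xs) v pos (suc i) (suc j) (s≤s i<j) σ>0 σ>0′ with *-positive (A u x) pos
      ... | A>0 , rest = ≤-trans (*-mono-< A>0 (walk₂-positive w x xs v rest i j i<j σ>0 σ>0′)) (m≤m+n _ _)

      walk≤1 : (∀ u v → A u v ≤ 1) → ∀ {N} u (xs : Vec (Fin n) N) v → walk u xs v ≤ 1
      walk≤1 A≤1 u []       v = A≤1 u v
      walk≤1 A≤1 u (x ∷ xs) v = *-mono-≤ (A≤1 u x) (walk≤1 A≤1 x xs v)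

    -- By `regroup` the middle norm is also the inner product of `pow m` and `pow (2 + m)`, to which
    -- Cauchy-Schwarz applies.
    closed-log-convex : ∀ m → closed (1 + m) * closed (1 + m) ≤ closed m * closed (2 + m)
    closed-log-convex m = subst (λ x → x * x ≤ closed m * closed (2 + m))
      (sym (regroup (1 + m) (1 + m) 0 0 m (2 + m) 0 0 A A (shift m) refl))
      (⟨⟩-cauchy-schwarz (pow m) (pow (2 + m)))
      where
      shift : ∀ p → (1 + p) + (1 + p) ≡ p + (2 + p)
      shift = solve-∀

    -- Cauchy-Schwarz on the `n` weighted diagonal entries of `A ∙ A`, whose squares are among the
    -- terms of `closed 1`. Here `n` stands in for the trace of the missing zeroth power.
    closed-base : closed 0 * closed 0 ≤ n * closed 1
    closed-base = begin
      closed 0 * closed 0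
        ≡⟨ cong₂ _*_ diagonal diagonal ⟩
      sum {n} (λ u → 1 * (1 * (c u * pow 1 u u))) * sum {n} (λ u → 1 * (1 * (c u * pow 1 u u)))
        ≤⟨ cauchy-schwarz {n} (λ _ → 1) (λ _ → 1) (λ u → c u * pow 1 u u) ⟩
      sum {n} (λ u → 1) * sum {n} (λ u → 1 * ((c u * pow 1 u u) * (c u * pow 1 u u)))
        ≤⟨ *-mono-≤ (≤-reflexive (sum-one n)) (sum-mono λ u →
             ≤-trans (≤-reflexive (square (c u) (pow 1 u u))) (term≤sum (λ v → c u * c v * (pow 1 u v * pow 1 u v)) u)) ⟩
      n * closed 1 ∎
      where
      open ≤-Reasoning
      square : ∀ a x → 1 * ((a * x) * (a * x)) ≡ a * a * (x * x)
      square = solve-∀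
      diagonal : closed 0 ≡ sum {n} (λ u → 1 * (1 * (c u * pow 1 u u)))
      diagonal = trans (sym (tr-pow 0)) (sum-cong-≗ {n} λ u → sym (trans (*-identityˡ _) (*-identityˡ _)))

    -- Let `t 0 = n` and `t (j + 1) = closed j`. By log-convexity `t j / t (j + 1)` is the least of
    -- the ratios up to there, so its `j`-th power is at most their telescoping product `t 0 / t j`;
    -- take `j = m + 1`.
    closed-ratio : (∀ m → 0 < closed m) → ∀ m → closed m ^ (2 + m) ≤ n * closed (1 + m) ^ (1 + m)
    closed-ratio pos zero    = subst₂ _≤_ (cong (closed 0 *_) (sym (*-identityʳ (closed 0))))
                                          (cong (n *_) (sym (*-identityʳ (closed 1)))) closed-base
    closed-ratio pos (suc m) = *-cancelˡ-≤ (x ^ suc m) {{>-nonZero (m^n>0 x {{>-nonZero (pos (1 + m))}} (suc m))}} (begin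
      x ^ suc m * x ^ (3 + m)                  ≡⟨ powers ⟩
      (x * x) ^ (2 + m)                        ≤⟨ ^-monoˡ-≤ (2 + m) (closed-log-convex m) ⟩
      (closed m * y) ^ (2 + m)                 ≡⟨ ^-distribʳ-* (2 + m) (closed m) y ⟩
      closed m ^ (2 + m) * y ^ (2 + m)         ≤⟨ *-monoˡ-≤ (y ^ (2 + m)) (closed-ratio pos m) ⟩
      n * x ^ (1 + m) * y ^ (2 + m)            ≡⟨ rotate n (x ^ (1 + m)) (y ^ (2 + m)) ⟩
      x ^ suc m * (n * y ^ (2 + m))            ∎)
      where
      open ≤-Reasoning
      x = closed (1 + m)
      y = closed (2 + m)
      rotate : ∀ a b c → a * b * c ≡ b * (a * c)
      rotate = solve-∀
      exponent : ∀ m → 1 + m + (3 + m) ≡ (2 + m) + (2 + m)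
      exponent = solve-∀
      powers : x ^ suc m * x ^ (3 + m) ≡ (x * x) ^ (2 + m)
      powers = trans (sym (^-distribˡ-+-* x (1 + m) (3 + m)))
        (trans (cong (x ^_) (exponent m)) (trans (^-distribˡ-+-* x (2 + m) (2 + m)) (sym (^-distribʳ-* (2 + m) x x))))

-- Degrees

-- `balanced` is `c u * deg u ≡ Λ`, multiplied by `A u v` so that isolated vertices satisfy it
-- trivially.
module Balanced {n : ℕ} (c : Fin n → ℕ) (A : Fin n → Fin n → ℕ) (A-sym : ∀ u v → A u v ≡ A v u) (Λ : ℕ)
         (balanced : ∀ u v → c u * sum (A u) * A u v ≡ Λ * A u v) where
    open Kernel c
    open Power A A-sym
    open Pairings c A A-sym

    deg : Fin n → ℕ
    deg u = sum (A u)

    total : Ker → ℕ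
    total X = sum λ u → sum λ v → X u v

    balanced-deg : ∀ u → c u * deg u * deg u ≡ Λ * deg u
    balanced-deg u = begin
      c u * deg u * deg u                      ≡⟨ *-distribˡ-sum (c u * deg u) (A u) ⟩
      sum (λ v → c u * deg u * A u v)          ≡⟨ sum-cong-≗ (balanced u) ⟩
      sum (λ v → Λ * A u v)                    ≡⟨ *-distribˡ-sum Λ (A u) ⟨
      Λ * deg u                                ∎
      where open ≡-Reasoning

    balanced-pow : ∀ m u v → c u * deg u * pow m u v ≡ Λ * pow m u v
    balanced-pow zero    u v = balanced u v
    balanced-pow (suc m) u v = begin
      c u * deg u * sum (λ t → c t * (A u t * pow m t v))
        ≡⟨ *-distribˡ-sum (c u * deg u) (λ t → c t * (A u t * pow m t v)) ⟩
      sum (λ t → c u * deg u * (c t * (A u t * pow m t v)))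
        ≡⟨ sum-cong-≗ (λ t → trans (pull (c u * deg u) (c t) (A u t) (pow m t v))
             (trans (cong (_* (c t * pow m t v)) (balanced u t)) (sym (pull Λ (c t) (A u t) (pow m t v))))) ⟩
      sum (λ t → Λ * (c t * (A u t * pow m t v)))
        ≡⟨ *-distribˡ-sum Λ (λ t → c t * (A u t * pow m t v)) ⟨
      Λ * pow (suc m) u v ∎
      where
      open ≡-Reasoning
      pull : ∀ k a x y → k * (a * (x * y)) ≡ k * x * (a * y)
      pull = solve-∀

    -- Summing out the start of the walk turns the weight `c t` of the next vertex into
    -- `c t * deg t`, which is `Λ`: the degree measure is stationary.
    total-pow : ∀ m → total (pow m) ≡ Λ ^ m * total A
    total-pow zero    = sym (*-identityˡ _)
    total-pow (suc m) = begin
      sum (λ u → sum λ v → sum λ t → c t * (A u t * pow m t v))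
        ≡⟨ sum-cong-≗ (λ u → ∑-comm λ v t → c t * (A u t * pow m t v)) ⟩
      sum (λ u → sum λ t → sum λ v → c t * (A u t * pow m t v))
        ≡⟨ ∑-comm (λ u t → sum λ v → c t * (A u t * pow m t v)) ⟩
      sum (λ t → sum λ u → sum λ v → c t * (A u t * pow m t v))
        ≡⟨ sum-cong-≗ (λ t → trans (∑-comm λ u v → c t * (A u t * pow m t v)) (sum-cong-≗ λ v → column t v)) ⟩
      sum (λ t → sum λ v → Λ * pow m t v)
        ≡⟨ trans (*-distribˡ-sum Λ λ t → sum (pow m t)) (sum-cong-≗ λ t → *-distribˡ-sum Λ (pow m t)) ⟨
      Λ * total (pow m)
        ≡⟨ cong (Λ *_) (total-pow m) ⟩
      Λ * (Λ ^ m * total A)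
        ≡⟨ *-assoc Λ (Λ ^ m) (total A) ⟨
      Λ ^ suc m * total A ∎
      where
      open ≡-Reasoning
      regroup′ : ∀ a x y → a * (x * y) ≡ a * y * x
      regroup′ = solve-∀
      regroup″ : ∀ a y x → a * y * x ≡ a * x * y
      regroup″ = solve-∀
      column : ∀ t v → sum (λ u → c t * (A u t * pow m t v)) ≡ Λ * pow m t v
      column t v = begin
        sum (λ u → c t * (A u t * pow m t v))
          ≡⟨ sum-cong-≗ (λ u → trans (regroup′ (c t) (A u t) (pow m t v)) (cong (c t * pow m t v *_) (A-sym u t))) ⟩
        sum (λ u → c t * pow m t v * A t u)
          ≡⟨ *-distribˡ-sum (c t * pow m t v) (A t) ⟨
        c t * pow m t v * deg t
          ≡⟨ regroup″ (c t) (pow m t v) (deg t) ⟩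
        c t * deg t * pow m t v
          ≡⟨ balanced-pow m t v ⟩
        Λ * pow m t v ∎

    -- Cauchy–Schwarz against deg u * deg v, the stationary measure of the walk.
    closed-lower : 0 < total A → ∀ m → 0 < Λ → Λ ^ (2 + (m + m)) ≤ closed m
    closed-lower pos m Λ>0 = *-cancelʳ-≤ _ _ (Λ * Λ * (D * D)) {{>-nonZero (*-mono-< (*-mono-< Λ>0 Λ>0) (*-mono-< pos pos))}} (begin
      Λ ^ (2 + (m + m)) * (Λ * Λ * (D * D))
        ≡⟨ cong (_* (Λ * Λ * (D * D))) (cong (λ x → Λ * (Λ * x)) (^-distribˡ-+-* Λ m m)) ⟩
      Λ * (Λ * (Λ ^ m * Λ ^ m)) * (Λ * Λ * (D * D))
        ≡⟨ arrange Λ (Λ ^ m) D ⟩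
      (Λ * Λ * (Λ ^ m * D)) * (Λ * Λ * (Λ ^ m * D))
        ≡⟨ cong₂ _*_ pairing pairing ⟨
      ⟨ pow m , dd ⟩ * ⟨ pow m , dd ⟩
        ≤⟨ ⟨⟩-cauchy-schwarz (pow m) dd ⟩
      closed m * ∥ dd ∥²
        ≡⟨ cong (closed m *_) norm ⟩
      closed m * (Λ * Λ * (D * D)) ∎)
      where
      open ≤-Reasoning
      D = total A
      dd : Ker
      dd u v = deg u * deg v
      arrange : ∀ a b x → a * (a * (b * b)) * (a * a * (x * x)) ≡ (a * a * (b * x)) * (a * a * (b * x))
      arrange = solve-∀
      pair : ∀ a b x s t → a * b * (x * (s * t)) ≡ b * t * (a * s * x)
      pair = solve-∀
      swap : ∀ a b x → a * (b * x) ≡ b * (a * x)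
      swap = solve-∀
      norm₁ : ∀ a b s t → a * b * ((s * t) * (s * t)) ≡ (a * s * s) * (b * t * t)
      norm₁ = solve-∀
      norm₂ : ∀ a s t → (a * s) * (a * t) ≡ a * a * s * t
      norm₂ = solve-∀
      pairing : ⟨ pow m , dd ⟩ ≡ Λ * Λ * (Λ ^ m * D)
      pairing = begin-equality
        ⟨ pow m , dd ⟩
          ≡⟨ (sum-cong-≗ λ u → sum-cong-≗ λ v → begin-equality
               c u * c v * (pow m u v * (deg u * deg v))   ≡⟨ pair (c u) (c v) (pow m u v) (deg u) (deg v) ⟩
               c v * deg v * (c u * deg u * pow m u v)     ≡⟨ cong (c v * deg v *_) (balanced-pow m u v) ⟩
               c v * deg v * (Λ * pow m u v)               ≡⟨ swap (c v * deg v) Λ (pow m u v) ⟩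
               Λ * (c v * deg v * pow m u v)               ≡⟨ cong (λ x → Λ * (c v * deg v * x)) (pow-sym m v u) ⟩
               Λ * (c v * deg v * pow m v u)               ≡⟨ cong (Λ *_) (balanced-pow m v u) ⟩
               Λ * (Λ * pow m v u)                         ≡⟨ *-assoc Λ Λ (pow m v u) ⟨
               Λ * Λ * pow m v u                           ≡⟨ cong (Λ * Λ *_) (pow-sym m u v) ⟩
               Λ * Λ * pow m u v                           ∎) ⟩
        sum (λ u → sum λ v → Λ * Λ * pow m u v)
          ≡⟨ trans (*-distribˡ-sum (Λ * Λ) λ u → sum (pow m u)) (sum-cong-≗ λ u → *-distribˡ-sum (Λ * Λ) (pow m u)) ⟨
        Λ * Λ * total (pow m)
          ≡⟨ cong (Λ * Λ *_) (total-pow m) ⟩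
        Λ * Λ * (Λ ^ m * D) ∎
      norm : ∥ dd ∥² ≡ Λ * Λ * (D * D)
      norm = begin-equality
        ∥ dd ∥²
          ≡⟨ (sum-cong-≗ λ u → sum-cong-≗ λ v → begin-equality
               c u * c v * ((deg u * deg v) * (deg u * deg v))   ≡⟨ norm₁ (c u) (c v) (deg u) (deg v) ⟩
               (c u * deg u * deg u) * (c v * deg v * deg v)     ≡⟨ cong₂ _*_ (balanced-deg u) (balanced-deg v) ⟩
               (Λ * deg u) * (Λ * deg v)                         ≡⟨ norm₂ Λ (deg u) (deg v) ⟩
               Λ * Λ * deg u * deg v                             ∎) ⟩
        sum (λ u → sum λ v → Λ * Λ * deg u * deg v)
          ≡⟨ sum-cong-≗ (λ u → *-distribˡ-sum (Λ * Λ * deg u) deg) ⟨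
        sum (λ u → Λ * Λ * deg u * D)
          ≡⟨ *-distribʳ-sum D (λ u → Λ * Λ * deg u) ⟨
        sum (λ u → Λ * Λ * deg u) * D
          ≡⟨ cong (_* D) (*-distribˡ-sum (Λ * Λ) deg) ⟨
        Λ * Λ * D * D
          ≡⟨ *-assoc (Λ * Λ) D D ⟩
        Λ * Λ * (D * D) ∎

    -- With Y = A^(k-1) this is the gain of a factor r²/θ over the closed walks two steps shorter.
    module Local (r θ : ℕ) (c≤ : ∀ u → θ * c u ≤ Λ) (deg≤ : ∀ u → deg u * c u ≤ Λ)
                 (K : Fin n → Ker) (row≤ : ∀ w u → sum (K w u) ≤ r) (marks≤ : ∀ u z → sum (λ w → K w u z) ≤ r * A u z) where

      -- Cauchy-Schwarz on each row of `K w` costs one factor `r`; summing out `w` costs the other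
      -- and leaves `A u z`. The weight of `u` contributes at most `Λ / θ`, and the sum over `u`
      -- gives `deg z`, which one of the two weights of `z` turns into at most `Λ`.
      local : ∀ Y → θ * sum (λ w → ∥ K w ∙ Y ∥²) ≤ r * r * (Λ * Λ) * ∥ Y ∥²
      local Y = begin
        θ * sum (λ w → ∥ K w ∙ Y ∥²)
          ≤⟨ *-monoʳ-≤ θ (sum-mono λ w → sum-mono λ u → sum-mono λ v → pointwise w u v) ⟩
        θ * sum (λ w → sum λ u → sum λ v → sum λ z → g w u v z)
          ≡⟨ cong (θ *_) (begin-equality
               sum (λ w → sum λ u → sum λ v → sum λ z → g w u v z)
                 ≡⟨ sum-cong-≗ (λ w → trans (sum-cong-≗ λ u → ∑-comm (g w u)) (∑-comm λ u z → sum λ v → g w u v z)) ⟩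
               sum (λ w → sum λ z → sum λ u → sum λ v → g w u v z)
                 ≡⟨ ∑-comm (λ w z → sum λ u → sum λ v → g w u v z) ⟩
               sum (λ z → sum λ w → sum λ u → sum λ v → g w u v z)
                 ≡⟨ sum-cong-≗ (λ z → trans (sum-cong-≗ λ w → ∑-comm λ u v → g w u v z) (∑-comm λ w v → sum λ u → g w u v z)) ⟩
               sum (λ z → sum λ v → sum λ w → sum λ u → g w u v z)
                 ≡⟨ sum-cong-≗ (λ z → sum-cong-≗ λ v → ∑-comm λ w u → g w u v z) ⟩
               sum (λ z → sum λ v → sum λ u → sum λ w → g w u v z) ∎) ⟩
        θ * sum (λ z → sum λ v → sum λ u → sum λ w → g w u v z)
          ≡⟨ trans (*-distribˡ-sum θ λ z → sum λ v → sum λ u → sum λ w → g w u v z)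
                   (sum-cong-≗ λ z → *-distribˡ-sum θ λ v → sum λ u → sum λ w → g w u v z) ⟩
        sum (λ z → sum λ v → θ * sum λ u → sum λ w → g w u v z)
          ≤⟨ sum-mono (λ z → sum-mono λ v → fibre z v) ⟩
        sum (λ z → sum λ v → r * r * (Λ * Λ) * (c z * c v * (Y z v * Y z v)))
          ≡⟨ trans (*-distribˡ-sum (r * r * (Λ * Λ)) λ z → sum λ v → c z * c v * (Y z v * Y z v))
                   (sum-cong-≗ λ z → *-distribˡ-sum (r * r * (Λ * Λ)) λ v → c z * c v * (Y z v * Y z v)) ⟨
        r * r * (Λ * Λ) * ∥ Y ∥² ∎
        where
        open ≤-Reasoning
        h : Fin n → Fin n → ℕ
        h z v = (c z * Y z v) * (c z * Y z v)
        g : Fin n → Fin n → Fin n → Fin n → ℕ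
        g w u v z = r * (c u * c v) * h z v * K w u z
        pointwise : ∀ w u v → c u * c v * ((K w ∙ Y) u v * (K w ∙ Y) u v) ≤ sum λ z → g w u v z
        pointwise w u v = begin
          c u * c v * ((K w ∙ Y) u v * (K w ∙ Y) u v)
            ≡⟨ cong (λ x → c u * c v * (x * x)) (sum-cong-≗ λ z → weight (c z) (K w u z) (Y z v)) ⟩
          c u * c v * (sum (λ z → K w u z * ((c z * Y z v) * 1)) * sum (λ z → K w u z * ((c z * Y z v) * 1)))
            ≤⟨ *-monoʳ-≤ (c u * c v) (cauchy-schwarz (K w u) (λ z → c z * Y z v) λ _ → 1) ⟩
          c u * c v * (sum (λ z → K w u z * h z v) * sum (λ z → K w u z * (1 * 1)))
            ≤⟨ *-monoʳ-≤ (c u * c v) (*-monoʳ-≤ (sum λ z → K w u z * h z v)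
                 (≤-trans (≤-reflexive (sum-cong-≗ λ z → *-identityʳ (K w u z))) (row≤ w u))) ⟩
          c u * c v * (sum (λ z → K w u z * h z v) * r)
            ≡⟨ reorder (c u * c v) (sum λ z → K w u z * h z v) r ⟩
          r * (c u * c v) * sum (λ z → K w u z * h z v)
            ≡⟨ *-distribˡ-sum (r * (c u * c v)) (λ z → K w u z * h z v) ⟩
          sum (λ z → r * (c u * c v) * (K w u z * h z v))
            ≡⟨ sum-cong-≗ (λ z → reorder′ (r * (c u * c v)) (K w u z) (h z v)) ⟩
          sum (λ z → g w u v z) ∎
          where
          weight : ∀ a x y → a * (x * y) ≡ x * ((a * y) * 1)
          weight = solve-∀
          reorder : ∀ a x y → a * (x * y) ≡ y * a * x
          reorder = solve-∀
          reorder′ : ∀ a x y → a * (x * y) ≡ a * y * x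
          reorder′ = solve-∀
        fibre : ∀ z v → θ * sum (λ u → sum λ w → g w u v z) ≤ r * r * (Λ * Λ) * (c z * c v * (Y z v * Y z v))
        fibre z v = begin
          θ * sum (λ u → sum λ w → g w u v z)
            ≡⟨ *-distribˡ-sum θ (λ u → sum λ w → g w u v z) ⟩
          sum (λ u → θ * sum λ w → g w u v z)
            ≤⟨ sum-mono (λ u → begin
                 θ * sum (λ w → g w u v z)
                   ≡⟨ cong (θ *_) (*-distribˡ-sum (r * (c u * c v) * h z v) λ w → K w u z) ⟨
                 θ * (r * (c u * c v) * h z v * sum (λ w → K w u z))
                   ≤⟨ *-monoʳ-≤ θ (*-monoʳ-≤ (r * (c u * c v) * h z v) (marks≤ u z)) ⟩
                 θ * (r * (c u * c v) * h z v * (r * A u z))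
                   ≡⟨ isolate θ r (c u) (c v) (h z v) (A u z) ⟩
                 θ * c u * (r * r * c v * h z v * A u z)
                   ≤⟨ *-monoˡ-≤ (r * r * c v * h z v * A u z) (c≤ u) ⟩
                 Λ * (r * r * c v * h z v * A u z)
                   ≡⟨ cong (λ x → Λ * (r * r * c v * h z v * x)) (A-sym u z) ⟩
                 Λ * (r * r * c v * h z v * A z u)
                   ≡⟨ *-assoc Λ (r * r * c v * h z v) (A z u) ⟨
                 Λ * (r * r * c v * h z v) * A z u ∎) ⟩
          sum (λ u → Λ * (r * r * c v * h z v) * A z u)
            ≡⟨ *-distribˡ-sum (Λ * (r * r * c v * h z v)) (A z) ⟨
          Λ * (r * r * c v * h z v) * deg z
            ≡⟨ isolate′ Λ r (c v) (c z) (Y z v) (deg z) ⟩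
          deg z * c z * (Λ * (r * r * (c z * c v * (Y z v * Y z v))))
            ≤⟨ *-monoˡ-≤ (Λ * (r * r * (c z * c v * (Y z v * Y z v)))) (deg≤ z) ⟩
          Λ * (Λ * (r * r * (c z * c v * (Y z v * Y z v))))
            ≡⟨ final Λ r (c z * c v * (Y z v * Y z v)) ⟩
          r * r * (Λ * Λ) * (c z * c v * (Y z v * Y z v)) ∎
          where
          isolate : ∀ θ r a b h x → θ * (r * (a * b) * h * (r * x)) ≡ θ * a * (r * r * b * h * x)
          isolate = solve-∀
          isolate′ : ∀ l r b a y d → l * (r * r * b * ((a * y) * (a * y))) * d ≡ d * a * (l * (r * r * (a * b * (y * y))))
          isolate′ = solve-∀
          final : ∀ l r x → l * (l * (r * r * x)) ≡ r * r * (l * l) * x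
          final = solve-∀

-- Conflicts of a closed walk

-- T w u v stands for the number of edges through u, v in which w is a third vertex.
module Conflicts {n : ℕ} (c : Fin n → ℕ) (A : Fin n → Fin n → ℕ) (A-sym : ∀ u v → A u v ≡ A v u) (Λ : ℕ)
         (balanced : ∀ u v → c u * sum (A u) * A u v ≡ Λ * A u v)
         (r θ : ℕ) (c≤ : ∀ u → θ * c u ≤ Λ) (deg≤ : ∀ u → sum (A u) * c u ≤ Λ)
         (r≥1 : 1 ≤ r) (A≤1 : ∀ u v → A u v ≤ 1) (A-irrefl : ∀ u → A u u ≡ 0)
         (T : Fin n → Fin n → Fin n → ℕ) (T-sym : ∀ w u v → T w u v ≡ T w v u) (T-irrefl : ∀ w v → T w w v ≡ 0)
         (T-row : ∀ w u → sum (T w u) ≤ r) (T-marks : ∀ u z → sum (λ w → T w u z) ≤ r * A u z) where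
    open Kernel c
    open Power A A-sym
    open Pairings c A A-sym
    open Balanced c A A-sym Λ balanced
    open Local r θ c≤ deg≤

    -- σ w u v marks the steps u → v that see w, the end v excluded: w is a third vertex of the
    -- edge or w = u.  As Q has a factor A on either side, it is symmetric and as local as T.
    U Uᵗ Q σ ς : Fin n → Ker
    U  w u v = A u w * δ v w
    Uᵗ w u v = A v w * δ u w
    Q  w     = U w ∙ A
    σ  w     = T w ⊞ Uᵗ w
    ς  w     = T w ⊞ U w

    U-row : ∀ w u → sum (U w u) ≤ r
    U-row w u = begin
      sum (λ v → A u w * δ v w)     ≡⟨ sum-cong-≗ (λ v → *-comm (A u w) (δ v w)) ⟩
      sum (λ v → δ v w * A u w)     ≡⟨ sum-δ w (λ _ → A u w) ⟩
      A u w                         ≤⟨ ≤-trans (A≤1 u w) r≥1 ⟩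
      r                             ∎
      where open ≤-Reasoning

    U-marks : ∀ u z → sum (λ w → U w u z) ≤ r * A u z
    U-marks u z = begin
      sum (λ w → A u w * δ z w)     ≡⟨ sum-cong-≗ (λ w → trans (*-comm (A u w) (δ z w)) (cong (_* A u w) (δ-sym z w))) ⟩
      sum (λ w → δ w z * A u w)     ≡⟨ sum-δ z (A u) ⟩
      A u z                         ≤⟨ m≤n*m (A u z) r {{>-nonZero r≥1}} ⟩
      r * A u z                     ∎
      where open ≤-Reasoning

    -- Both kernels are `c w * (A u w * A w v)`, two consecutive steps through `w`. This common form
    -- is what makes `Q` symmetric.
    A∙Uᵗ : ∀ w → A ∙ Uᵗ w ≈ Q w
    A∙Uᵗ w u v = begin
      sum (λ t → c t * (A u t * (A v w * δ t w)))   ≡⟨ sum-cong-≗ (λ t → pull (c t) (A u t) (A v w) (δ t w)) ⟩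
      sum (λ t → δ t w * (c t * (A u t * A v w)))   ≡⟨ sum-δ w (λ t → c t * (A u t * A v w)) ⟩
      c w * (A u w * A v w)                         ≡⟨ cong (λ x → c w * (A u w * x)) (A-sym v w) ⟩
      c w * (A u w * A w v)                         ≡⟨ sum-δ w (λ t → c t * (A u w * A t v)) ⟨
      sum (λ t → δ t w * (c t * (A u w * A t v)))   ≡⟨ sum-cong-≗ (λ t → pull′ (c t) (A u w) (δ t w) (A t v)) ⟨
      sum (λ t → c t * (A u w * δ t w * A t v))     ∎
      where
      open ≡-Reasoning
      pull : ∀ a x y d → a * (x * (y * d)) ≡ d * (a * (x * y))
      pull = solve-∀
      pull′ : ∀ a x d y → a * (x * d * y) ≡ d * (a * (x * y))
      pull′ = solve-∀

    Q-sym : ∀ w → flip (Q w) ≈ Q w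
    Q-sym w = ≈-trans (∙-flip (U w) A) (≈-trans (∙-congʳ (Uᵗ w) λ u v → A-sym v u) (A∙Uᵗ w))

    -- The bound for `θ` times one pairing on closed walks of `2m + 4` steps; `closed m` has two
    -- steps fewer.
    B : ℕ → ℕ
    B m = r * r * (Λ * Λ) * closed m

    R^-localise : ∀ m X → R^ m (X ∙ A) ≈ X ∙ pow m
    R^-localise m X = ≈-trans (R^-∙ m X A) (∙-congˡ X (R^-pow m))

    T-bounded : ∀ m → Bounded θ (B m) (1 + m) T
    T-bounded m = bounded θ (B m) (1 + m) T (λ w u v → T-sym w v u)
      (subst (λ x → θ * x ≤ B m) (sum-cong-≗ λ w → ⟨⟩-cong (localised w) (localised w)) (local T T-row T-marks (pow m)))
      where
      localised : ∀ w → T w ∙ pow m ≈ R^ (1 + m) (T w)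
      localised w = ≈-trans (≈-sym (R^-localise m (T w))) (R^-shift m (T w))

    -- `Q` already contains one factor `A`, so `m` further ones give `U w ∙ pow m`, to which `local`
    -- applies; `T` takes `1 + m` for the same reason.
    Q-bounded : ∀ m → Bounded θ (B m) m Q
    Q-bounded m = bounded θ (B m) m Q Q-sym
      (subst (λ x → θ * x ≤ B m) (sum-cong-≗ λ w → ⟨⟩-cong (localised w) (localised w)) (local U U-row U-marks (pow m)))
      where
      localised : ∀ w → U w ∙ pow m ≈ R^ m (Q w)
      localised w = ≈-sym (R^-localise m (U w))

    ⟨⟩-distribʳ : ∀ X Y Z → ⟨ X ⊞ Y , Z ⟩ ≡ ⟨ X , Z ⟩ + ⟨ Y , Z ⟩
    ⟨⟩-distribʳ X Y Z = trans (⟨⟩-sym (X ⊞ Y) Z)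
      (trans (⟨⟩-distribˡ Z X Y) (cong₂ _+_ (⟨⟩-sym Z X) (⟨⟩-sym Z Y)))

    -- A step does not see its own end, and steps put before it leave that end unchanged.
    column-zero : ∀ b w u → L^ b (σ w) u w ≡ 0
    column-zero zero    w u = cong₂ _+_ (trans (T-sym w u w) (T-irrefl w u)) (cong (_* δ u w) (A-irrefl w))
    column-zero (suc b) w u = sum-zero λ t → trans (cong (λ x → c t * (A u t * x)) (column-zero b w t))
      (trans (cong (c t *_) (*-zeroʳ (A u t))) (*-zeroʳ (c t)))

    -- Of two consecutive steps that see w, the later one sees it as a third vertex of its edge.
    drop-U : ∀ b w → ⟨ ς w , L^ b (σ w) ⟩ ≡ ⟨ T w , L^ b (σ w) ⟩
    drop-U b w = sum-cong-≗ λ u → sum-cong-≗ λ v → cong (c u * c v *_) (begin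
      (T w u v + A u w * δ v w) * X u v              ≡⟨ expand (T w u v) (A u w) (δ v w) (X u v) ⟩
      T w u v * X u v + A u w * (δ v w * X u v)      ≡⟨ cong (λ x → T w u v * X u v + A u w * x) (δ-replace v w (X u)) ⟩
      T w u v * X u v + A u w * (δ v w * X u w)      ≡⟨ cong (λ x → T w u v * X u v + A u w * (δ v w * x)) (column-zero b w u) ⟩
      T w u v * X u v + A u w * (δ v w * 0)          ≡⟨ cong (T w u v * X u v +_) (vanish (A u w) (δ v w)) ⟩
      T w u v * X u v + 0                            ≡⟨ +-identityʳ _ ⟩
      T w u v * X u v                                ∎)
      where
      open ≡-Reasoning
      X = L^ b (σ w)
      expand : ∀ t a d x → (t + a * d) * x ≡ t * x + a * (d * x)
      expand = solve-∀
      vanish : ∀ a d → a * (d * 0) ≡ 0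
      vanish = solve-∀

    -- The asymmetric part `Uᵗ` absorbs the nearest factor `A` and becomes `Q`; this needs at least
    -- one factor, hence `suc b`.
    L^-σ : ∀ b w → L^ (suc b) (σ w) ≈ L^ (suc b) (T w) ⊞ L^ b (Q w)
    L^-σ b w = ≈-trans (L^-⊞ (suc b) (T w) (Uᵗ w)) λ u v →
      cong (L^ (suc b) (T w) u v +_) (≈-trans (≈-sym (L^-shift b (Uᵗ w))) (L^-cong b (A∙Uᵗ w)) u v)

    R^-ς : ∀ a w → R^ (suc a) (ς w) ≈ R^ (suc a) (T w) ⊞ R^ a (Q w)
    R^-ς a w = ≈-trans (R^-⊞ (suc a) (T w) (U w)) λ u v →
      cong (R^ (suc a) (T w) u v +_) (≈-sym (R^-shift a (U w)) u v)

    sum-split : ∀ (f g : Fin n → ℕ) x y → θ * sum f ≤ x → θ * sum g ≤ y → θ * sum (λ w → f w + g w) ≤ x + y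
    sum-split f g x y p q = subst (_≤ x + y)
      (sym (trans (cong (θ *_) (∑-distrib-+ f g)) (*-distribˡ-+ θ (sum f) (sum g)))) (+-mono-≤ p q)

    -- The marks are adjacent on one side, so `U` has no factor `A` to absorb there. `drop-U`
    -- removes it, and only the pairings of `T` with `T` and with `Q` remain; the bound `4 * B m` is
    -- kept for uniformity with the general case.
    conflict-T : ∀ m b → b ≡ 2 + (m + m) → θ * sum (λ w → ⟨ ς w , L^ b (σ w) ⟩) ≤ 4 * B m
    conflict-T m (suc b) b≡ = begin
      θ * sum (λ w → ⟨ ς w , L^ (suc b) (σ w) ⟩)
        ≡⟨ cong (θ *_) (sum-cong-≗ λ w → trans (drop-U (suc b) w)
             (trans (⟨⟩-cong {X = T w} (λ _ _ → refl) (L^-σ b w)) (⟨⟩-distribˡ (T w) (L^ (suc b) (T w)) (L^ b (Q w))))) ⟩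
      θ * sum (λ w → ⟨ T w , L^ (suc b) (T w) ⟩ + ⟨ T w , L^ b (Q w) ⟩)
        ≤⟨ sum-split (λ w → ⟨ T w , L^ (suc b) (T w) ⟩) (λ w → ⟨ T w , L^ b (Q w) ⟩) (B m) (B m)
             (pairing≤ θ (B m) T T (T-bounded m) (T-bounded m) 0 (suc b) (trans b≡ (cong suc (sym (+-suc m m)))))
             (pairing≤ θ (B m) T Q (T-bounded m) (Q-bounded m) 0 b (suc-injective b≡)) ⟩
      B m + B m
        ≤⟨ m≤m+n _ (B m + B m) ⟩
      B m + B m + (B m + B m)
        ≡⟨ four (B m) ⟩
      4 * B m ∎
      where
      open ≤-Reasoning
      four : ∀ x → x + x + (x + x) ≡ 4 * x
      four = solve-∀

    -- With unmarked steps in both gaps each mark splits into `T` and `Q`, and the 4 counts the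
    -- resulting pairings. Each `Q` uses up one of the `2 + 2m` unmarked steps, exactly the
    -- difference between `T-bounded` and `Q-bounded`.
    conflict′ : ∀ m a b → a + b ≡ 2 + (m + m) → θ * sum (λ w → ⟨ R^ a (ς w) , L^ b (σ w) ⟩) ≤ 4 * B m
    conflict′ m zero    b       eq = conflict-T m b eq
    -- Transposition reverses the walk and moves the empty gap to the other side of the pairing.
    conflict′ m (suc a) zero    eq = subst (λ x → θ * x ≤ 4 * B m)
      (sum-cong-≗ λ w → begin
        ⟨ ς w , L^ (suc a) (σ w) ⟩              ≡⟨ ⟨⟩-cong flip-σ (λ _ _ → refl) ⟩
        ⟨ flip (σ w) , L^ (suc a) (σ w) ⟩       ≡⟨ ⟨⟩-flip (flip (σ w)) (L^ (suc a) (σ w)) ⟨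
        ⟨ σ w , flip (L^ (suc a) (σ w)) ⟩
          ≡⟨ ⟨⟩-cong {X = σ w} (λ _ _ → refl) (≈-trans (L^-flip (suc a) (σ w)) (R^-cong (suc a) (≈-sym flip-σ))) ⟩
        ⟨ σ w , R^ (suc a) (ς w) ⟩              ≡⟨ ⟨⟩-sym (σ w) (R^ (suc a) (ς w)) ⟩
        ⟨ R^ (suc a) (ς w) , σ w ⟩              ∎)
      (conflict-T m (suc a) (trans (sym (+-identityʳ (suc a))) eq))
      where
      open ≡-Reasoning
      flip-σ : ∀ {w} → ς w ≈ flip (σ w)
      flip-σ {w} u v = cong (_+ A u w * δ v w) (T-sym w u v)
    conflict′ m (suc a) (suc b) eq = begin
      θ * sum (λ w → ⟨ R^ (suc a) (ς w) , L^ (suc b) (σ w) ⟩)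
        ≡⟨ cong (θ *_) (sum-cong-≗ expand) ⟩
      θ * sum (λ w → (⟨ R^ (suc a) (T w) , L^ (suc b) (T w) ⟩ + ⟨ R^ (suc a) (T w) , L^ b (Q w) ⟩)
                   + (⟨ R^ a (Q w) , L^ (suc b) (T w) ⟩ + ⟨ R^ a (Q w) , L^ b (Q w) ⟩))
        ≤⟨ sum-split TT+TQ QT+QQ (B m + B m) (B m + B m)
             (sum-split (λ w → ⟨ R^ (suc a) (T w) , L^ (suc b) (T w) ⟩) (λ w → ⟨ R^ (suc a) (T w) , L^ b (Q w) ⟩) (B m) (B m)
               (pairing≤ θ (B m) T T (T-bounded m) (T-bounded m) (suc a) (suc b) (trans eq (cong suc (sym (+-suc m m)))))
               (pairing≤ θ (B m) T Q (T-bounded m) (Q-bounded m) (suc a) b eq′))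
             (sum-split (λ w → ⟨ R^ a (Q w) , L^ (suc b) (T w) ⟩) (λ w → ⟨ R^ a (Q w) , L^ b (Q w) ⟩) (B m) (B m)
               (pairing≤ θ (B m) Q T (Q-bounded m) (T-bounded m) a (suc b) (trans (suc-injective eq) (sym (+-suc m m))))
               (pairing≤ θ (B m) Q Q (Q-bounded m) (Q-bounded m) a b (suc-injective eq′))) ⟩
      B m + B m + (B m + B m)
        ≡⟨ four (B m) ⟩
      4 * B m ∎
      where
      open ≤-Reasoning
      four : ∀ x → x + x + (x + x) ≡ 4 * x
      four = solve-∀
      eq′ : suc a + b ≡ 1 + m + m
      eq′ = suc-injective (trans (sym (+-suc (suc a) b)) eq)
      TT+TQ QT+QQ : Fin n → ℕ
      TT+TQ w = ⟨ R^ (suc a) (T w) , L^ (suc b) (T w) ⟩ + ⟨ R^ (suc a) (T w) , L^ b (Q w) ⟩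
      QT+QQ w = ⟨ R^ a (Q w) , L^ (suc b) (T w) ⟩ + ⟨ R^ a (Q w) , L^ b (Q w) ⟩
      expand : ∀ w → ⟨ R^ (suc a) (ς w) , L^ (suc b) (σ w) ⟩ ≡ TT+TQ w + QT+QQ w
      expand w = trans (⟨⟩-cong (R^-ς a w) (L^-σ b w))
        (trans (⟨⟩-distribʳ (R^ (suc a) (T w)) (R^ a (Q w)) (L^ (suc b) (T w) ⊞ L^ b (Q w)))
          (cong₂ _+_ (⟨⟩-distribˡ (R^ (suc a) (T w)) (L^ (suc b) (T w)) (L^ b (Q w)))
                     (⟨⟩-distribˡ (R^ a (Q w)) (L^ (suc b) (T w)) (L^ b (Q w)))))

    -- The closed walk reads `σ`, `a` unmarked steps, `σ`, `b` unmarked steps. Writing the trace as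
    -- a pairing transposes the second mark into `ς`.
    conflict : ∀ m a b → a + b ≡ 2 + (m + m) → θ * sum (λ w → tr (σ w ∙ R^ b (L^ a (σ w)))) ≤ 4 * B m
    conflict m a b eq = subst (λ x → θ * x ≤ 4 * B m) (sum-cong-≗ λ w → sym (begin
      tr (σ w ∙ R^ b (L^ a (σ w)))              ≡⟨ tr-∙ (σ w) (R^ b (L^ a (σ w))) ⟩
      ⟨ σ w , flip (R^ b (L^ a (σ w))) ⟩
        ≡⟨ ⟨⟩-cong {X = σ w} (λ _ _ → refl)
             (≈-trans (R^-flip b (L^ a (σ w))) (L^-cong b (≈-trans (L^-flip a (σ w)) (R^-cong a (flip-σ w))))) ⟩
      ⟨ σ w , L^ b (R^ a (ς w)) ⟩               ≡⟨ L^-adjoint b (σ w) (R^ a (ς w)) ⟨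
      ⟨ L^ b (σ w) , R^ a (ς w) ⟩               ≡⟨ ⟨⟩-sym (L^ b (σ w)) (R^ a (ς w)) ⟩
      ⟨ R^ a (ς w) , L^ b (σ w) ⟩               ∎)) (conflict′ m a b eq)
      where
      open ≡-Reasoning
      flip-σ : ∀ w → flip (σ w) ≈ ς w
      flip-σ w u v = cong (_+ A u w * δ v w) (T-sym w v u)

    -- Summing over the positions of the two marks

    open Marks σ

    σ∙pow : ∀ N w → σ w ∙ pow N ≈ R^ (suc N) (σ w)
    σ∙pow N w = ≈-trans (≈-sym (R^-localise N (σ w))) (R^-shift N (σ w))

    -- one-mark and two-marks sum over all positions of the marks among the N + 1 steps of a path.
    one-mark-bound : ∀ m N i a → i + a + N ≡ 2 + (m + m) →
                     θ * sum (λ w → tr (σ w ∙ R^ i (L^ a (one-mark w N)))) ≤ (1 + N) * (4 * B m)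
    one-mark-bound m zero    i a eq = subst (θ * sum (λ w → tr (σ w ∙ R^ i (L^ a (σ w)))) ≤_) (sym (*-identityˡ (4 * B m)))
      (conflict m a i (trans (+-comm a i) (trans (sym (+-identityʳ (i + a))) eq)))
    one-mark-bound m (suc N) i a eq = begin
      θ * sum (λ w → tr (σ w ∙ R^ i (L^ a (one-mark w (suc N)))))
        ≡⟨ cong (θ *_) (sum-cong-≗ expand) ⟩
      θ * sum (λ w → tr (σ w ∙ R^ (i + suc N) (L^ a (σ w))) + tr (σ w ∙ R^ i (L^ (suc a) (one-mark w N))))
        ≤⟨ sum-split _ _ (4 * B m) ((1 + N) * (4 * B m))
             (conflict m a (i + suc N) (trans (shuffle a i N) eq))
             (one-mark-bound m N i (suc a) (trans (shuffle′ a i N) eq)) ⟩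
      4 * B m + (1 + N) * (4 * B m) ∎
      where
      open ≤-Reasoning
      shuffle : ∀ a i N → a + (i + suc N) ≡ i + a + suc N
      shuffle = solve-∀
      shuffle′ : ∀ a i N → i + suc a + N ≡ i + a + suc N
      shuffle′ = solve-∀
      expand : ∀ w → tr (σ w ∙ R^ i (L^ a (one-mark w (suc N))))
                   ≡ tr (σ w ∙ R^ (i + suc N) (L^ a (σ w))) + tr (σ w ∙ R^ i (L^ (suc a) (one-mark w N)))
      expand w = begin-equality
        tr (σ w ∙ R^ i (L^ a (A ∙ one-mark w N ⊞ σ w ∙ pow N)))
          ≡⟨ tr-cong (∙-congˡ (σ w) (≈-trans (R^-cong i (L^-⊞ a (A ∙ one-mark w N) (σ w ∙ pow N)))
                                             (R^-⊞ i (L^ a (A ∙ one-mark w N)) (L^ a (σ w ∙ pow N))))) ⟩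
        tr (σ w ∙ (R^ i (L^ a (A ∙ one-mark w N)) ⊞ R^ i (L^ a (σ w ∙ pow N))))
          ≡⟨ tr-cong (∙-distribˡ (σ w) (R^ i (L^ a (A ∙ one-mark w N))) (R^ i (L^ a (σ w ∙ pow N)))) ⟩
        tr (σ w ∙ R^ i (L^ a (A ∙ one-mark w N)) ⊞ σ w ∙ R^ i (L^ a (σ w ∙ pow N)))
          ≡⟨ tr-⊞ (σ w ∙ R^ i (L^ a (A ∙ one-mark w N))) (σ w ∙ R^ i (L^ a (σ w ∙ pow N))) ⟩
        tr (σ w ∙ R^ i (L^ a (A ∙ one-mark w N))) + tr (σ w ∙ R^ i (L^ a (σ w ∙ pow N)))
          ≡⟨ cong₂ _+_ (tr-cong (∙-congˡ (σ w) (R^-cong i (L^-shift a (one-mark w N)))))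
                       (tr-cong (∙-congˡ (σ w) (≈-trans (R^-cong i (≈-trans (L^-cong a (σ∙pow N w)) (≈-sym (R^L^-comm (suc N) a (σ w)))))
                                                        (R^-+ i (suc N) (L^ a (σ w)))))) ⟩
        tr (σ w ∙ R^ i (L^ (suc a) (one-mark w N))) + tr (σ w ∙ R^ (i + suc N) (L^ a (σ w)))
          ≡⟨ +-comm (tr (σ w ∙ R^ i (L^ (suc a) (one-mark w N)))) _ ⟩
        _ ∎

    tr-L^R^ : ∀ i X → tr (L^ i X) ≡ tr (R^ i X)
    tr-L^R^ zero    X = refl
    tr-L^R^ (suc i) X = begin
      tr (A ∙ L^ i X)       ≡⟨ tr-comm A (L^ i X) ⟩
      tr (L^ i X ∙ A)       ≡⟨ tr-cong (L^-∙ i X A) ⟨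
      tr (L^ i (X ∙ A))     ≡⟨ tr-L^R^ i (X ∙ A) ⟩
      tr (R^ i (X ∙ A))     ≡⟨ tr-cong (R^-shift i X) ⟩
      tr (R^ (suc i) X)     ∎
      where open ≡-Reasoning

    -- `L^ i` holds the unmarked steps before the first mark. Once the next step is marked,
    -- cyclicity moves them to the end and `one-mark-bound` counts the partners. This gives
    -- `N (N + 1) / 2` pairs, rounded up to `N * N`.
    two-marks-bound : ∀ m N i → i + N ≡ 3 + (m + m) →
                      θ * sum (λ w → tr (L^ i (two-marks w N))) ≤ N * N * (4 * B m)
    two-marks-bound m zero i eq = ≤-reflexive (trans (cong (θ *_) (sum-zero λ w → trace-zero w)) (*-zeroʳ θ))
      where
      L^-zero : ∀ i u v → L^ i (λ _ _ → 0) u v ≡ 0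
      L^-zero zero    u v = refl
      L^-zero (suc i) u v = sum-zero λ t → trans (cong (λ x → c t * (A u t * x)) (L^-zero i t v))
        (trans (cong (c t *_) (*-zeroʳ (A u t))) (*-zeroʳ (c t)))
      trace-zero : ∀ (w : Fin n) → tr (L^ i (λ _ _ → 0)) ≡ 0
      trace-zero w = sum-zero λ u → trans (cong (c u *_) (L^-zero i u u)) (*-zeroʳ (c u))
    two-marks-bound m (suc N) i eq = begin
      θ * sum (λ w → tr (L^ i (two-marks w (suc N))))
        ≡⟨ cong (θ *_) (sum-cong-≗ expand) ⟩
      θ * sum (λ w → tr (σ w ∙ R^ i (one-mark w N)) + tr (L^ (suc i) (two-marks w N)))
        ≤⟨ sum-split _ _ ((1 + N) * (4 * B m)) (N * N * (4 * B m))
             (one-mark-bound m N i 0 (trans (cong (_+ N) (+-identityʳ i)) (suc-injective (trans (sym (+-suc i N)) eq))))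
             (two-marks-bound m N (suc i) (trans (sym (+-suc i N)) eq)) ⟩
      (1 + N) * (4 * B m) + N * N * (4 * B m)
        ≤⟨ m≤m+n _ (N * (4 * B m)) ⟩
      (1 + N) * (4 * B m) + N * N * (4 * B m) + N * (4 * B m)
        ≡⟨ square N (4 * B m) ⟩
      (1 + N) * (1 + N) * (4 * B m) ∎
      where
      open ≤-Reasoning
      square : ∀ N x → (1 + N) * x + N * N * x + N * x ≡ (1 + N) * (1 + N) * x
      square = solve-∀
      expand : ∀ w → tr (L^ i (two-marks w (suc N))) ≡ tr (σ w ∙ R^ i (one-mark w N)) + tr (L^ (suc i) (two-marks w N))
      expand w = begin-equality
        tr (L^ i (A ∙ two-marks w N ⊞ σ w ∙ one-mark w N))
          ≡⟨ tr-cong (L^-⊞ i (A ∙ two-marks w N) (σ w ∙ one-mark w N)) ⟩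
        tr (L^ i (A ∙ two-marks w N) ⊞ L^ i (σ w ∙ one-mark w N))
          ≡⟨ tr-⊞ (L^ i (A ∙ two-marks w N)) (L^ i (σ w ∙ one-mark w N)) ⟩
        tr (L^ i (A ∙ two-marks w N)) + tr (L^ i (σ w ∙ one-mark w N))
          ≡⟨ cong₂ _+_ (tr-cong (L^-shift i (two-marks w N)))
               (trans (tr-L^R^ i (σ w ∙ one-mark w N)) (tr-cong (R^-∙ i (σ w) (one-mark w N)))) ⟩
        tr (L^ (suc i) (two-marks w N)) + tr (σ w ∙ R^ i (one-mark w N))
          ≡⟨ +-comm (tr (L^ (suc i) (two-marks w N))) _ ⟩
        _ ∎

    closed-positive : 0 < total A → 0 < Λ → ∀ m → 0 < closed m
    closed-positive A>0 Λ>0 m = ≤-trans (m^n>0 Λ {{>-nonZero Λ>0}} (2 + (m + m))) (closed-lower A>0 m Λ>0)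

    -- In the `k`-th power of the hypothesis `closed-ratio` replaces `x ^ k` by `n * y ^ (k - 1)`;
    -- the factor `y` still missing comes from `Λ ^ (2k) ≤ y`, and then `y ^ k` cancels.
    min-degree-bound : 0 < total A → 0 < Λ → ∀ m N → θ * closed (1 + m) ≤ N * (4 * B m) →
                       θ ^ (2 + m) ≤ (N * (4 * (r * r))) ^ (2 + m) * n
    min-degree-bound A>0 Λ>0 m N bound = *-cancelʳ-≤ _ _ (y ^ k) {{>-nonZero (m^n>0 y {{>-nonZero (closed-positive A>0 Λ>0 (1 + m))}} k)}} (begin
      θ ^ k * y ^ k                                   ≡⟨ ^-distribʳ-* k θ y ⟨
      (θ * y) ^ k                                     ≤⟨ ^-monoˡ-≤ k bound ⟩
      (N * (4 * (r * r * (Λ * Λ) * x))) ^ k           ≡⟨ cong (_^ k) (rearrange N r Λ x) ⟩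
      (M * (x * (Λ * Λ))) ^ k                         ≡⟨ ^-distribʳ-* k M (x * (Λ * Λ)) ⟩
      M ^ k * (x * (Λ * Λ)) ^ k                       ≡⟨ cong (M ^ k *_) (^-distribʳ-* k x (Λ * Λ)) ⟩
      M ^ k * (x ^ k * (Λ * Λ) ^ k)                   ≤⟨ *-monoʳ-≤ (M ^ k) (*-mono-≤ (closed-ratio (closed-positive A>0 Λ>0) m) lower) ⟩
      M ^ k * (n * y ^ (1 + m) * y)                   ≡⟨ collect (M ^ k) n (y ^ (1 + m)) y ⟩
      M ^ k * n * y ^ k                               ∎)
      where
      open ≤-Reasoning
      k = 2 + m
      x = closed m
      y = closed (1 + m)
      M = N * (4 * (r * r))
      rearrange : ∀ N r l x → N * (4 * (r * r * (l * l) * x)) ≡ N * (4 * (r * r)) * (x * (l * l))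
      rearrange = solve-∀
      collect : ∀ a b p q → a * (b * p * q) ≡ a * b * (q * p)
      collect = solve-∀
      exponent : ∀ m → 2 + m + (2 + m) ≡ 2 + (1 + m + (1 + m))
      exponent = solve-∀
      lower : (Λ * Λ) ^ k ≤ y
      lower = subst (_≤ y) (trans (cong (Λ ^_) (sym (exponent m))) (trans (^-distribˡ-+-* Λ k k) (sym (^-distribʳ-* k Λ Λ))))
                (closed-lower A>0 (1 + m) Λ>0)

-- Linear cycles and the shadow of a linear hypergraph

cpred : ∀ {N} → Fin (suc N) → Fin (suc N)
cpred {N} zero    = fromℕ N
cpred     (suc i) = inject₁ i

-- e i ∖ {x i} are the vertices counted at the edge e i, so these sets are disjoint and
-- consecutive edges e i and e (i + 1) meet in x i.
record LinearCycle {N n : ℕ} (r : ℕ) (e : Fin (suc N) → Subset n) : Set where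
  field
    card     : ∀ i → ∣ e i ∣ ≡ r
    x        : Fin (suc N) → Fin n
    x∈       : ∀ i → x i ∈ e i
    x-pred∈  : ∀ i → x (cpred i) ∈ e i
    x≢       : ∀ i → x i ≢ x (cpred i)
    disjoint : ∀ {i j y} → i ≢ j → y ∈ e i → y ≢ x i → y ∈ e j → y ≢ x j → ⊥

χ : ∀ {n} → Subset n → Fin n → ℕ
χ p x with lookup p x
... | true  = 1
... | false = 0

χ≤1 : ∀ {n} (p : Subset n) x → χ p x ≤ 1
χ≤1 p x with lookup p x
... | true  = ≤-refl
... | false = z≤n

χ-∈ : ∀ {n} {p : Subset n} {x} → x ∈ p → χ p x ≡ 1
χ-∈ {p = p} {x} x∈p with lookup p x | []=⇒lookup x∈p
... | true | refl = refl

χ-positive : ∀ {n} (p : Subset n) x → 0 < χ p x → x ∈ p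
χ-positive p x pos with lookup p x in eq
... | true  = lookup⇒[]= x p eq
... | false = ⊥-elim (n≮0 pos)

sum-χ : ∀ {n} (p : Subset n) → sum (χ p) ≡ ∣ p ∣
sum-χ []          = refl
sum-χ (true  ∷ p) = cong suc (sum-χ p)
sum-χ (false ∷ p) = sum-χ p

δ̄ : ∀ {n} → Fin n → Fin n → ℕ
δ̄ u v = 1 ∸ δ u v

δ̄-refl : ∀ {n} (u : Fin n) → δ̄ u u ≡ 0
δ̄-refl u = cong (1 ∸_) (δ-refl u)

δ̄-≢ : ∀ {n} {u v : Fin n} → u ≢ v → δ̄ u v ≡ 1
δ̄-≢ u≢v = cong (1 ∸_) (δ-≢ u≢v)

δ̄-sym : ∀ {n} (u v : Fin n) → δ̄ u v ≡ δ̄ v u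
δ̄-sym u v = cong (1 ∸_) (δ-sym u v)

δ̄≤1 : ∀ {n} (u v : Fin n) → δ̄ u v ≤ 1
δ̄≤1 u v = m∸n≤m 1 (δ u v)

δ̄-positive : ∀ {n} (u v : Fin n) → 0 < δ̄ u v → u ≢ v
δ̄-positive u v pos refl = n≮0 (subst (0 <_) (δ̄-refl u) pos)

∣-! : ∀ n {m} → 0 < m → m ≤ n → m ∣ n !
∣-! zero    0<m m≤0 = ⊥-elim (<⇒≱ 0<m m≤0)
∣-! (suc n) 0<m m≤n with m≤n⇒m<n∨m≡n m≤n
... | inj₁ (s≤s m≤n′) = ∣n⇒∣m*n (suc n) (∣-! n 0<m m≤n′)
... | inj₂ refl       = ∣m⇒∣m*n (n !) ∣-refl

-- Λ / d, except that it is 0 when d = 0.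
share : ℕ → ℕ → ℕ
share Λ zero      = 0
share Λ d@(suc _) = Λ / d

share-* : ∀ {Λ d} → d ∣ Λ → 0 < d → share Λ d * d ≡ Λ
share-* {d = suc d} d∣Λ _ = m/n*n≡m d∣Λ

module Shadow {M n : ℕ} (r : ℕ) (e : Fin M → Subset n) (uniform : ∀ i → ∣ e i ∣ ≡ r)
              (linear : ∀ i j {u v} → i ≢ j → u ∈ e i → v ∈ e i → u ∈ e j → v ∈ e j → u ≡ v) where

  A : Fin n → Fin n → ℕ
  A u v = sum λ i → χ (e i) u * χ (e i) v * δ̄ u v

  T : Fin n → Fin n → Fin n → ℕ
  T w u v = sum λ i → χ (e i) u * χ (e i) v * χ (e i) w * (δ̄ u v * δ̄ w u * δ̄ w v)

  edge-deg : Fin n → ℕ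
  edge-deg u = sum λ i → χ (e i) u

  A-term : ∀ {u v} i → 0 < χ (e i) u * χ (e i) v * δ̄ u v → u ∈ e i × v ∈ e i × u ≢ v
  A-term {u} {v} i pos with *-positive (χ (e i) u * χ (e i) v) pos
  ... | χχ , d with *-positive (χ (e i) u) χχ
  ...   | χu , χv = χ-positive (e i) u χu , χ-positive (e i) v χv , δ̄-positive u v d

  A-positive⁻ : ∀ {u v} → 0 < A u v → ∃[ i ] (u ∈ e i × v ∈ e i × u ≢ v)
  A-positive⁻ {u} {v} pos with sum-positive (λ i → χ (e i) u * χ (e i) v * δ̄ u v) pos
  ... | i , term>0 = i , A-term i term>0

  A-positive⁺ : ∀ {u v} i → u ∈ e i → v ∈ e i → u ≢ v → 0 < A u v
  A-positive⁺ {u} {v} i u∈ v∈ u≢v = ≤-trans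
    (≤-reflexive (sym (cong₂ _*_ (cong₂ _*_ (χ-∈ u∈) (χ-∈ v∈)) (δ̄-≢ u≢v))))
    (term≤sum (λ i → χ (e i) u * χ (e i) v * δ̄ u v) i)

  T-positive⁺ : ∀ {w u v} i → u ∈ e i → v ∈ e i → w ∈ e i → u ≢ v → w ≢ u → w ≢ v → 0 < T w u v
  T-positive⁺ {w} {u} {v} i u∈ v∈ w∈ u≢v w≢u w≢v = ≤-trans
    (≤-reflexive (sym (cong₂ _*_ (cong₂ _*_ (cong₂ _*_ (χ-∈ u∈) (χ-∈ v∈)) (χ-∈ w∈))
                                 (cong₂ _*_ (cong₂ _*_ (δ̄-≢ u≢v) (δ̄-≢ w≢u)) (δ̄-≢ w≢v)))))
    (term≤sum (λ i → χ (e i) u * χ (e i) v * χ (e i) w * (δ̄ u v * δ̄ w u * δ̄ w v)) i)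

  A-sym : ∀ u v → A u v ≡ A v u
  A-sym u v = sum-cong-≗ λ i → cong₂ _*_ (*-comm (χ (e i) u) (χ (e i) v)) (δ̄-sym u v)

  A≤1 : ∀ u v → A u v ≤ 1
  A≤1 u v = sum-≤1 _ (λ i → *-mono-≤ (*-mono-≤ (χ≤1 (e i) u) (χ≤1 (e i) v)) (δ̄≤1 u v)) same
    where
    same : ∀ i j → 0 < χ (e i) u * χ (e i) v * δ̄ u v → 0 < χ (e j) u * χ (e j) v * δ̄ u v → i ≡ j
    same i j p q with i Finₚ.≟ j | A-term i p | A-term j q
    ... | yes i≡j | _ | _ = i≡j
    ... | no  i≢j | u∈i , v∈i , u≢v | u∈j , v∈j , _ = ⊥-elim (u≢v (linear i j i≢j u∈i v∈i u∈j v∈j))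

  A-irrefl : ∀ u → A u u ≡ 0
  A-irrefl u = sum-zero λ i → trans (cong (χ (e i) u * χ (e i) u *_) (δ̄-refl u)) (*-zeroʳ (χ (e i) u * χ (e i) u))

  T-sym : ∀ w u v → T w u v ≡ T w v u
  T-sym w u v = sum-cong-≗ λ i → trans (cong (λ d → χ (e i) u * χ (e i) v * χ (e i) w * (d * δ̄ w u * δ̄ w v)) (δ̄-sym u v))
    (swap (χ (e i) u) (χ (e i) v) (χ (e i) w) (δ̄ v u) (δ̄ w u) (δ̄ w v))
    where
    swap : ∀ a b c x y z → a * b * c * (x * y * z) ≡ b * a * c * (x * z * y)
    swap = solve-∀

  T-irrefl : ∀ w v → T w w v ≡ 0
  T-irrefl w v = sum-zero λ i → trans (cong (λ d → χ (e i) w * χ (e i) v * χ (e i) w * (δ̄ w v * d * δ̄ w v)) (δ̄-refl w))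
    (vanish (χ (e i) w * χ (e i) v * χ (e i) w) (δ̄ w v))
    where
    vanish : ∀ a d → a * (d * 0 * d) ≡ 0
    vanish = solve-∀

  sum-edges : ∀ (f : Fin M → ℕ) → sum (λ v → sum λ i → f i * χ (e i) v) ≡ sum f * r
  sum-edges f = begin
    sum (λ v → sum λ i → f i * χ (e i) v)     ≡⟨ ∑-comm (λ v i → f i * χ (e i) v) ⟩
    sum (λ i → sum λ v → f i * χ (e i) v)     ≡⟨ sum-cong-≗ (λ i → *-distribˡ-sum (f i) (χ (e i))) ⟨
    sum (λ i → f i * sum (χ (e i)))           ≡⟨ sum-cong-≗ (λ i → cong (f i *_) (trans (sum-χ (e i)) (uniform i))) ⟩
    sum (λ i → f i * r)                       ≡⟨ *-distribʳ-sum r f ⟨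
    sum f * r                                 ∎
    where open ≡-Reasoning

  -- By linearity at most one edge contains the distinct vertices `w` and `u`, and it offers at most
  -- `r` choices for the remaining vertex.
  T-row : ∀ w u → sum (T w u) ≤ r
  T-row w u = begin
    sum (T w u)
      ≤⟨ sum-mono (λ z → sum-mono λ i → begin
           χ (e i) u * χ (e i) z * χ (e i) w * (δ̄ u z * δ̄ w u * δ̄ w z)
             ≤⟨ *-monoʳ-≤ (χ (e i) u * χ (e i) z * χ (e i) w) (*-mono-≤ (*-monoˡ-≤ (δ̄ w u) (δ̄≤1 u z)) (δ̄≤1 w z)) ⟩
           χ (e i) u * χ (e i) z * χ (e i) w * (1 * δ̄ w u * 1)
             ≡⟨ cong (λ d → χ (e i) u * χ (e i) z * χ (e i) w * (1 * d * 1)) (δ̄-sym w u) ⟩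
           χ (e i) u * χ (e i) z * χ (e i) w * (1 * δ̄ u w * 1)
             ≡⟨ reorder (χ (e i) u) (χ (e i) z) (χ (e i) w) (δ̄ u w) ⟩
           χ (e i) u * χ (e i) w * δ̄ u w * χ (e i) z ∎) ⟩
    sum (λ z → sum λ i → χ (e i) u * χ (e i) w * δ̄ u w * χ (e i) z)
      ≡⟨ sum-edges (λ i → χ (e i) u * χ (e i) w * δ̄ u w) ⟩
    A u w * r
      ≤⟨ *-monoˡ-≤ r (A≤1 u w) ⟩
    1 * r
      ≡⟨ *-identityˡ r ⟩
    r ∎
    where
    open ≤-Reasoning
    reorder : ∀ a b c d → a * b * c * (1 * d * 1) ≡ a * c * d * b
    reorder = solve-∀

  T-marks : ∀ u z → sum (λ w → T w u z) ≤ r * A u z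
  T-marks u z = begin
    sum (λ w → T w u z)
      ≤⟨ sum-mono (λ w → sum-mono λ i → begin
           χ (e i) u * χ (e i) z * χ (e i) w * (δ̄ u z * δ̄ w u * δ̄ w z)
             ≤⟨ *-monoʳ-≤ (χ (e i) u * χ (e i) z * χ (e i) w) (*-mono-≤ (*-monoʳ-≤ (δ̄ u z) (δ̄≤1 w u)) (δ̄≤1 w z)) ⟩
           χ (e i) u * χ (e i) z * χ (e i) w * (δ̄ u z * 1 * 1)
             ≡⟨ reorder (χ (e i) u) (χ (e i) z) (χ (e i) w) (δ̄ u z) ⟩
           χ (e i) u * χ (e i) z * δ̄ u z * χ (e i) w ∎) ⟩
    sum (λ w → sum λ i → χ (e i) u * χ (e i) z * δ̄ u z * χ (e i) w)
      ≡⟨ sum-edges (λ i → χ (e i) u * χ (e i) z * δ̄ u z) ⟩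
    A u z * r
      ≡⟨ *-comm (A u z) r ⟩
    r * A u z ∎
    where
    open ≤-Reasoning
    reorder : ∀ a b c d → a * b * c * (d * 1 * 1) ≡ a * b * d * c
    reorder = solve-∀

  -- Each edge through `u` has a second vertex because `2 ≤ r`. This carries the minimum degree from
  -- the hypergraph to its shadow.
  edge-deg≤ : 2 ≤ r → ∀ u → edge-deg u ≤ sum (A u)
  edge-deg≤ 2≤r u = begin
    sum (λ i → χ (e i) u)                                       ≡⟨ sum-cong-≗ (λ i → *-identityʳ (χ (e i) u)) ⟨
    sum (λ i → χ (e i) u * 1)                                   ≤⟨ sum-mono (λ i → *-monoʳ-≤ (χ (e i) u) (others i)) ⟩
    sum (λ i → χ (e i) u * sum (λ v → χ (e i) v * δ̄ u v))       ≡⟨ sum-cong-≗ (λ i → *-distribˡ-sum (χ (e i) u) λ v → χ (e i) v * δ̄ u v) ⟩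
    sum (λ i → sum λ v → χ (e i) u * (χ (e i) v * δ̄ u v))       ≡⟨ ∑-comm (λ i v → χ (e i) u * (χ (e i) v * δ̄ u v)) ⟩
    sum (λ v → sum λ i → χ (e i) u * (χ (e i) v * δ̄ u v))
      ≡⟨ sum-cong-≗ (λ v → sum-cong-≗ λ i → *-assoc (χ (e i) u) (χ (e i) v) (δ̄ u v)) ⟨
    sum (A u)                                                   ∎
    where
    open ≤-Reasoning
    split : ∀ i v → χ (e i) v ≤ χ (e i) v * δ̄ u v + δ v u
    split i v with v Finₚ.≟ u
    ... | yes refl = ≤-trans (χ≤1 (e i) v) (m≤n+m 1 _)
    ... | no  v≢u  = ≤-reflexive (sym (trans (+-identityʳ _) (trans (cong (χ (e i) v *_) (δ̄-≢ (v≢u ∘ sym))) (*-identityʳ (χ (e i) v)))))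
    others : ∀ i → 1 ≤ sum (λ v → χ (e i) v * δ̄ u v)
    others i = +-cancelʳ-≤ 1 _ _ (begin
      2                                                     ≤⟨ 2≤r ⟩
      r                                                     ≡⟨ trans (sum-χ (e i)) (uniform i) ⟨
      sum (χ (e i))                                         ≤⟨ sum-mono (split i) ⟩
      sum (λ v → χ (e i) v * δ̄ u v + δ v u)                 ≡⟨ ∑-distrib-+ (λ v → χ (e i) v * δ̄ u v) (λ v → δ v u) ⟩
      sum (λ v → χ (e i) v * δ̄ u v) + sum (λ v → δ v u)
        ≡⟨ cong (sum (λ v → χ (e i) v * δ̄ u v) +_) (trans (sum-cong-≗ λ v → sym (*-identityʳ (δ v u))) (sum-δ u λ _ → 1)) ⟩
      sum (λ v → χ (e i) v * δ̄ u v) + 1                     ∎)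

  deg≤n : ∀ u → sum (A u) ≤ n
  deg≤n u = ≤-trans (sum-mono (A≤1 u)) (≤-reflexive (sum-one n))

  isolated : ∀ u → edge-deg u ≡ 0 → sum (A u) ≡ 0
  isolated u d≡0 = sum-zero λ v → sum-zero λ i →
    cong (λ x → x * χ (e i) v * δ̄ u v) (n≤0⇒n≡0 (subst (χ (e i) u ≤_) d≡0 (term≤sum (λ i → χ (e i) u) i)))

  -- Weights on the shadow, and linear cycles from walks without conflict

  module _ (2≤r : 2 ≤ r) (θ : ℕ) (min-deg : ∀ u → edge-deg u ≡ 0 ⊎ θ ≤ edge-deg u) where

    -- Degrees in the shadow are at most `n`, so every positive one divides `n !` and the weights
    -- `Λ / deg u` are integers.
    Λ : ℕ
    Λ = n !

    c : Fin n → ℕ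
    c u = share Λ (sum (A u))

    c-deg : ∀ u → sum (A u) ≡ 0 ⊎ (θ ≤ sum (A u) × c u * sum (A u) ≡ Λ)
    c-deg u with sum (A u) in eq
    ... | zero = inj₁ refl
    ... | suc d with min-deg u
    ...   | inj₁ d≡0 = ⊥-elim (1+n≢0 (trans (sym eq) (isolated u d≡0)))
    ...   | inj₂ θ≤d = inj₂ (subst (θ ≤_) eq (≤-trans θ≤d (edge-deg≤ 2≤r u)) ,
                             share-* (∣-! n z<s (subst (_≤ n) eq (deg≤n u))) z<s)

    balanced : ∀ u v → c u * sum (A u) * A u v ≡ Λ * A u v
    balanced u v with c-deg u
    ... | inj₂ (_ , cd) = cong (_* A u v) cd
    ... | inj₁ d≡0      = trans (cong (c u * sum (A u) *_) A≡0)
                            (trans (*-zeroʳ (c u * sum (A u))) (sym (trans (cong (Λ *_) A≡0) (*-zeroʳ Λ))))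
      where
      A≡0 : A u v ≡ 0
      A≡0 = n≤0⇒n≡0 (subst (A u v ≤_) d≡0 (term≤sum (A u) v))

    c≤ : ∀ u → θ * c u ≤ Λ
    c≤ u with c-deg u
    ... | inj₂ (θ≤d , cd) = ≤-trans (*-monoˡ-≤ (c u) θ≤d) (≤-reflexive (trans (*-comm (sum (A u)) (c u)) cd))
    ... | inj₁ d≡0        = ≤-trans (≤-reflexive (trans (cong (λ d → θ * share Λ d) d≡0) (*-zeroʳ θ))) z≤n

    deg≤ : ∀ u → sum (A u) * c u ≤ Λ
    deg≤ u with c-deg u
    ... | inj₂ (_ , cd) = ≤-reflexive (trans (*-comm (sum (A u)) (c u)) cd)
    ... | inj₁ d≡0      = ≤-trans (≤-reflexive (cong (_* c u) d≡0)) z≤n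

    open Kernel c
    open Power A A-sym
    open Pairings c A A-sym
    open Balanced c A A-sym Λ balanced
    open Conflicts c A A-sym Λ balanced r θ c≤ deg≤ (≤-trans (s≤s z≤n) 2≤r) A≤1 A-irrefl T T-sym T-irrefl T-row T-marks
    open Marks σ

    σ-positive : ∀ {w u v} i → u ∈ e i → v ∈ e i → u ≢ v → w ∈ e i → w ≢ v → 0 < σ w u v
    σ-positive {w} {u} {v} i u∈ v∈ u≢v w∈ w≢v = cases (w Finₚ.≟ u)
      where
      cases : Dec (w ≡ u) → 0 < σ w u v
      cases (no w≢u)   = ≤-trans (T-positive⁺ i u∈ v∈ w∈ u≢v w≢u w≢v) (m≤m+n (T w u v) (Uᵗ w u v))
      cases (yes refl) = ≤-trans (*-mono-< (A-positive⁺ i v∈ u∈ (u≢v ∘ sym)) (≤-reflexive (sym (δ-refl u))))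
                                 (m≤n+m (Uᵗ u u v) (T u u v))

    -- Each step selects a hyperedge through its two ends. Two hyperedges sharing a vertex other
    -- than the ends of their steps would be two steps seeing that vertex, so the absence of
    -- conflicts is the disjointness required of a linear cycle.
    walk-cycle : ∀ {N} u (xs : Vec (Fin n) N) → 0 < walk u xs u → (∀ w → walk₂ w u xs u ≡ 0) →
                 Σ (Fin (suc N) → Fin M) λ ι → LinearCycle r (e ∘ ι)
    walk-cycle {N} u xs pos unmarked = ι , record
      { card     = uniform ∘ ι
      ; x        = x
      ; x∈       = λ i → proj₁ (proj₂ (proj₂ (step i)))
      ; x-pred∈  = λ i → subst (_∈ e (ι i)) (start i) (proj₁ (proj₂ (step i)))
      ; x≢       = λ i x≡ → proj₂ (proj₂ (proj₂ (step i))) (trans (start i) (sym x≡))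
      ; disjoint = disjoint
      }
      where
      s x : Fin (suc N) → Fin n
      s = lookup (u ∷ xs)
      x = lookup (xs ∷ʳ u)
      step : ∀ i → ∃[ j ] (s i ∈ e j × x i ∈ e j × s i ≢ x i)
      step i = A-positive⁻ (walk-step u xs u pos i)
      ι : Fin (suc N) → Fin M
      ι i = proj₁ (step i)
      start : ∀ i → s i ≡ x (cpred i)
      start zero    = last-lookup xs
        where
        last-lookup : ∀ {N} (xs : Vec (Fin n) N) → u ≡ lookup (xs ∷ʳ u) (fromℕ N)
        last-lookup []       = refl
        last-lookup (y ∷ xs) = last-lookup xs
      start (suc i) = init-lookup xs i
        where
        init-lookup : ∀ {N} (xs : Vec (Fin n) N) i → lookup xs i ≡ lookup (xs ∷ʳ u) (inject₁ i)
        init-lookup (y ∷ xs) zero    = refl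
        init-lookup (y ∷ xs) (suc i) = init-lookup xs i
      σ-step : ∀ {w} i → w ∈ e (ι i) → w ≢ x i → 0 < σ w (s i) (x i)
      σ-step i w∈ w≢ =
        σ-positive (ι i) (proj₁ (proj₂ (step i))) (proj₁ (proj₂ (proj₂ (step i)))) (proj₂ (proj₂ (proj₂ (step i)))) w∈ w≢
      ordered : ∀ {w i j} → i Fin.< j → w ∈ e (ι i) → w ≢ x i → w ∈ e (ι j) → w ≢ x j → ⊥
      ordered {w} {i} {j} i<j w∈i w≢i w∈j w≢j =
        n≮0 (subst (0 <_) (unmarked w) (walk₂-positive w u xs u pos i j i<j (σ-step i w∈i w≢i) (σ-step j w∈j w≢j)))
      disjoint : ∀ {i j y} → i ≢ j → y ∈ e (ι i) → y ≢ x i → y ∈ e (ι j) → y ≢ x j → ⊥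
      disjoint {i} {j} i≢j y∈i y≢i y∈j y≢j with Finₚ.<-cmp i j
      ... | tri< i<j _ _ = ordered i<j y∈i y≢i y∈j y≢j
      ... | tri≈ _ i≡j _ = i≢j i≡j
      ... | tri> _ _ j<i = ordered j<i y∈j y≢j y∈i y≢i

    cycle-free-bound : ∀ m → 0 < M → ¬ (Σ (Fin (4 + (m + m)) → Fin M) λ ι → LinearCycle r (e ∘ ι)) →
                       θ ^ (2 + m) ≤ ((3 + (m + m)) * (3 + (m + m)) * (4 * (r * r))) ^ (2 + m) * n
    cycle-free-bound m M>0 no-cycle = min-degree-bound A>0 (n! n) m (len * len) (begin
      θ * closed (1 + m)
        ≡⟨ cong (θ *_) (trans (sym (tr-pow (1 + m))) (cong (λ l → tr (pow (1 + l))) (+-suc m (1 + m)))) ⟩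
      θ * tr (pow (2 + (m + (1 + m))))
        ≡⟨ cong (λ l → θ * tr (pow (2 + l))) (+-suc m m) ⟩
      θ * tr (pow len)
        ≤⟨ *-monoʳ-≤ θ (tr-pow≤two-marks len marked) ⟩
      θ * sum (λ w → tr (two-marks w len))
        ≤⟨ two-marks-bound m len 0 refl ⟩
      len * len * (4 * B m) ∎)
      where
      open ≤-Reasoning
      -- `pow len` has `len + 1 = 2k` factors for `k = 2 + m`; `len` counts the inner vertices of
      -- the walk.
      len = 3 + (m + m)
      n! : ∀ n → 0 < n !
      n! zero    = ≤-refl
      n! (suc n) = *-mono-< (z<s {n}) (n! n)
      marked : ∀ u (xs : Vec (Fin n) len) → walk u xs u ≤ sum λ w → walk₂ w u xs u
      -- `walk` takes only the values 0 and 1, so a single conflict dominates it; value 1 without a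
      -- conflict would produce a linear cycle.
      marked u xs with walk u xs u in eq | sum (λ w → walk₂ w u xs u) in eq₂
      ... | zero  | _     = z≤n
      ... | suc k | suc l = ≤-trans (subst (_≤ 1) eq (walk≤1 A≤1 u xs u)) (s≤s z≤n)
      ... | suc k | zero  = ⊥-elim (no-cycle (walk-cycle u xs (subst (0 <_) (sym eq) z<s)
                              λ w → n≤0⇒n≡0 (subst (walk₂ w u xs u ≤_) eq₂ (term≤sum (λ w → walk₂ w u xs u) w))))
      A>0 : 0 < total A
      A>0 with sum-positive (χ (e i₀)) (subst (0 <_) (sym (trans (sum-χ (e i₀)) (uniform i₀))) (≤-trans (s≤s z≤n) 2≤r))
        where
        i₀ : Fin M
        i₀ = Fin.fromℕ< M>0
      ... | u , χ>0 = ≤-trans χ>0 (≤-trans (term≤sum (λ i → χ (e i) u) (Fin.fromℕ< M>0))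
                        (≤-trans (edge-deg≤ 2≤r u) (term≤sum (λ u → sum (A u)) u)))

-- Embedding linear cycles

card-remove : ∀ {n} {p : Subset n} {x} → x ∈ p → suc ∣ p - x ∣ ≡ ∣ p ∣
card-remove {p = true ∷ p}  here        = cong (suc ∘ ∣_∣) (p─⊥≡p p)
card-remove {p = true ∷ p}  (there x∈p) = cong suc (card-remove x∈p)
card-remove {p = false ∷ p} (there x∈p) = card-remove x∈p

x∉p-x : ∀ {n} (p : Subset n) x → ¬ x ∈ p - x
x∉p-x (true  ∷ p) zero    ()
x∉p-x (false ∷ p) zero    ()
x∉p-x (b ∷ p)     (suc x) (there x∈) = x∉p-x p x x∈

two≤card : ∀ {n} {p : Subset n} {x y} → x ∈ p → y ∈ p → x ≢ y → 2 ≤ ∣ p ∣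
two≤card {p = p} {x} {y} x∈p y∈p x≢y = begin
  2                       ≤⟨ s≤s (s≤s z≤n) ⟩
  2 + ∣ p - x - y ∣       ≡⟨ cong suc (card-remove (x∈p∧x≢y⇒x∈p-y y∈p (x≢y ∘ sym))) ⟩
  1 + ∣ p - x ∣           ≡⟨ card-remove x∈p ⟩
  ∣ p ∣                   ∎
  where open ≤-Reasoning

record Enumeration {n} (s : ℕ) (p : Subset n) : Set where
  field
    at        : Fin s → Fin n
    at∈       : ∀ t → at t ∈ p
    injective : ∀ {t t′} → at t ≡ at t′ → t ≡ t′
    index     : ∀ {x} → x ∈ p → ∃[ t ] at t ≡ x

enumerate : ∀ {n} (p : Subset n) → Enumeration ∣ p ∣ p
enumerate [] = record { at = λ () ; at∈ = λ () ; injective = λ { {()} } ; index = λ () }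
enumerate (false ∷ p) = record
  { at        = suc ∘ at
  ; at∈       = there ∘ at∈
  ; injective = injective ∘ Finₚ.suc-injective
  ; index     = λ { (there x∈p) → let t , eq = index x∈p in t , cong suc eq }
  }
  where open Enumeration (enumerate p)
enumerate (true ∷ p) = record
  { at        = λ { zero → zero ; (suc t) → suc (at t) }
  ; at∈       = λ { zero → here ; (suc t) → there (at∈ t) }
  ; injective = λ { {zero} {zero} _ → refl
                  ; {suc _} {suc _} eq → cong suc (injective (Finₚ.suc-injective eq)) }
  ; index     = λ { here → zero , refl
                  ; (there x∈p) → let t , eq = index x∈p in suc t , cong suc eq }
  }
  where open Enumeration (enumerate p)

abstract
  -- A missed value could be punched out of the codomain, leaving an injection from `suc n` points
  -- into `n`.
  injective⇒surjective : ∀ {n} {f : Fin n → Fin n} → (∀ {i j} → f i ≡ f j → i ≡ j) → ∀ y → ∃[ x ] f x ≡ y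
  injective⇒surjective {suc n} {f} inj y with Finₚ.any? (λ x → f x Finₚ.≟ y)
  ... | yes found = found
  ... | no  missed = contradict (Finₚ.pigeonhole (n<1+n n) λ x → punchOut (avoid x))
    where
    avoid : ∀ x → y ≢ f x
    avoid x y≡fx = missed (x , sym y≡fx)
    contradict : ∃[ i ] ∃[ j ] (i Fin.< j × punchOut (avoid i) ≡ punchOut (avoid j)) → ∃[ x ] f x ≡ y
    contradict (i , j , i<j , eq) = ⊥-elim (Finₚ.<-irrefl (inj (Finₚ.punchOut-injective (avoid i) (avoid j) eq)) i<j)

-- The r - 1 vertices of e i ∖ {x i}, the vertex shared with the preceding edge first.
module Labelling {s N n : ℕ} {e : Fin (suc N) → Subset n} (C : LinearCycle (2 + s) e) where
  open LinearCycle C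

  interior : Fin (suc N) → Subset n
  interior i = e i - x i - x (cpred i)

  enumeration : ∀ i → Enumeration s (interior i)
  enumeration i = subst (λ s → Enumeration s (interior i)) size-interior (enumerate (interior i))
    where
    size-interior : ∣ interior i ∣ ≡ s
    size-interior = suc-injective (suc-injective (trans
      (cong suc (card-remove (x∈p∧x≢y⇒x∈p-y (x-pred∈ i) (x≢ i ∘ sym))))
      (trans (card-remove (x∈ i)) (card i))))

  module At i = Enumeration (enumeration i)

  label : Fin (suc s) → Fin (suc N) → Fin n
  label zero    i = x (cpred i)
  label (suc t) i = At.at i t

  label∈ : ∀ t i → label t i ∈ e i
  label∈ zero    i = x-pred∈ i
  label∈ (suc t) i = p─q⊆p (e i) _ (p─q⊆p (e i - x i) _ (At.at∈ i t))

  label≢ : ∀ t i → label t i ≢ x i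
  label≢ zero    i eq = x≢ i (sym eq)
  label≢ (suc t) i eq = x∉p-x (e i) (x i) (subst (_∈ e i - x i) eq (p─q⊆p (e i - x i) _ (At.at∈ i t)))

  label-index : ∀ {y} i → y ∈ e i → y ≡ x i ⊎ ∃[ t ] label t i ≡ y
  label-index {y} i y∈ with y Finₚ.≟ x i | y Finₚ.≟ x (cpred i)
  ... | yes y≡x | _       = inj₁ y≡x
  ... | no  _   | yes y≡x = inj₂ (zero , sym y≡x)
  ... | no  y≢x | no y≢x′ with At.index i (x∈p∧x≢y⇒x∈p-y (x∈p∧x≢y⇒x∈p-y y∈ y≢x) y≢x′)
  ...   | t , eq = inj₂ (suc t , eq)

  label-injectiveʳ : ∀ {t t′ i i′} → label t i ≡ label t′ i′ → i ≡ i′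
  label-injectiveʳ {t} {t′} {i} {i′} eq with i Finₚ.≟ i′
  ... | yes i≡i′ = i≡i′
  ... | no  i≢i′ = ⊥-elim (disjoint i≢i′ (label∈ t i) (label≢ t i)
                     (subst (_∈ e i′) (sym eq) (label∈ t′ i′)) (label≢ t′ i′ ∘ trans (sym eq)))

  label-injectiveˡ : ∀ t t′ i → label t i ≡ label t′ i → t ≡ t′
  label-injectiveˡ zero    zero     i eq = refl
  label-injectiveˡ (suc t) (suc t′) i eq = cong suc (At.injective i eq)
  label-injectiveˡ zero    (suc t′) i eq =
    ⊥-elim (x∉p-x (e i - x i) (x (cpred i)) (subst (_∈ interior i) (sym eq) (At.at∈ i t′)))
  label-injectiveˡ (suc t) zero     i eq =
    ⊥-elim (x∉p-x (e i - x i) (x (cpred i)) (subst (_∈ interior i) eq (At.at∈ i t)))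

  vertex : Fin (suc s * suc N) → Fin n
  vertex z = uncurry label (remQuot (suc N) z)

  vertex-combine : ∀ t i → vertex (combine t i) ≡ label t i
  vertex-combine t i = cong (uncurry label) (Finₚ.remQuot-combine t i)

  vertex-injective : ∀ z z′ → vertex z ≡ vertex z′ → z ≡ z′
  vertex-injective z z′ eq = begin
    z                                            ≡⟨ Finₚ.combine-remQuot (suc N) z ⟨
    uncurry combine (remQuot {suc s} (suc N) z)  ≡⟨ pairs (remQuot (suc N) z) (remQuot (suc N) z′) eq ⟩
    uncurry combine (remQuot {suc s} (suc N) z′) ≡⟨ Finₚ.combine-remQuot (suc N) z′ ⟩
    z′                                           ∎
    where
    open ≡-Reasoning
    pairs : ∀ p q → uncurry label p ≡ uncurry label q → uncurry combine p ≡ uncurry combine q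
    pairs (t , i) (t′ , i′) eq with refl ← label-injectiveʳ {t} {t′} {i} {i′} eq =
      cong (λ t → combine t i) (label-injectiveˡ t t′ i eq)

cpred-injective : ∀ {N} {i j : Fin (suc N)} → cpred i ≡ cpred j → i ≡ j
cpred-injective {i = zero}  {zero}  eq = refl
cpred-injective {i = zero}  {suc j} eq = ⊥-elim (Finₚ.fromℕ≢inject₁ eq)
cpred-injective {i = suc i} {zero}  eq = ⊥-elim (Finₚ.fromℕ≢inject₁ (sym eq))
cpred-injective {i = suc i} {suc j} eq = cong suc (Finₚ.inject₁-injective eq)

cpred-surjective : ∀ {N} (i : Fin (suc N)) → ∃[ j ] cpred j ≡ i
cpred-surjective = injective⇒surjective cpred-injective

from-does : ∀ {P : Set} (d : Dec P) → does d ≡ true → P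
from-does (yes p) _ = p

module _ {m n} (φ : Fin m → Fin n) (p : Subset m) where

  hit? : ∀ y → Dec (∃[ x ] (x ∈ p × φ x ≡ y))
  hit? y = Finₚ.any? λ x → (x ∈? p) ×-dec (φ x Finₚ.≟ y)

  ∈-image⁻ : ∀ {y} → y ∈ image φ p → ∃[ x ] (x ∈ p × φ x ≡ y)
  ∈-image⁻ {y} y∈ = from-does (hit? y) (trans (sym (lookup∘tabulate (does ∘ hit?) y)) ([]=⇒lookup y∈))

  ∈-image⁺ : ∀ {x} → x ∈ p → φ x ∈ image φ p
  ∈-image⁺ {x} x∈ = lookup⇒[]= (φ x) _ (trans (lookup∘tabulate (does ∘ hit?) (φ x)) (dec-true (hit? (φ x)) (x , x∈ , refl)))

module Embedding {s N n : ℕ} {e : Fin (suc N) → Subset (suc s * suc N)} {f : Fin (suc N) → Subset n}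
                 (C : LinearCycle (2 + s) e) (D : LinearCycle (2 + s) f) where
  module C = Labelling C
  module D = Labelling D
  open LinearCycle

  -- The vertex set of the cycle has exactly as many points as there are labels, so the injective
  -- labelling is onto. Sending each vertex to the one with the same label in `D` is then the
  -- embedding.
  code : ∀ y → ∃[ z ] C.vertex z ≡ y
  code = injective⇒surjective λ {z} {z′} → C.vertex-injective z z′

  φ : Fin (suc s * suc N) → Fin n
  φ y = D.vertex (proj₁ (code y))

  φ-injective : Injective _≡_ _≡_ φ
  φ-injective {y} {y′} eq =
    trans (sym (proj₂ (code y))) (trans (cong C.vertex (D.vertex-injective (proj₁ (code y)) (proj₁ (code y′)) eq)) (proj₂ (code y′)))

  φ-label : ∀ t i → φ (C.label t i) ≡ D.label t i
  φ-label t i = trans (cong D.vertex (C.vertex-injective (proj₁ (code (C.label t i))) (combine t i) (trans (proj₂ (code (C.label t i))) (sym (C.vertex-combine t i)))))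
                      (D.vertex-combine t i)

  φ-x : ∀ i → φ (x C i) ≡ x D i
  -- `x i` has no label at the edge `i`; it is the label `zero` of the following edge.
  φ-x i with cpred-surjective i
  ... | j , refl = φ-label zero j

  image-edge : ∀ i → image φ (e i) ≡ f i
  image-edge i = ⊆-antisym image⊆ ⊆image
    where
    image⊆ : ∀ {y} → y ∈ image φ (e i) → y ∈ f i
    image⊆ y∈ with ∈-image⁻ φ (e i) y∈
    ... | v , v∈ , refl with C.label-index i v∈
    ...   | inj₁ refl       = subst (_∈ f i) (sym (φ-x i)) (x∈ D i)
    ...   | inj₂ (t , refl) = subst (_∈ f i) (sym (φ-label t i)) (D.label∈ t i)
    ⊆image : ∀ {y} → y ∈ f i → y ∈ image φ (e i)
    ⊆image y∈ with D.label-index i y∈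
    ... | inj₁ refl       = subst (_∈ image φ (e i)) (φ-x i) (∈-image⁺ φ (e i) (x∈ C i))
    ... | inj₂ (t , refl) = subst (_∈ image φ (e i)) (φ-label t i) (∈-image⁺ φ (e i) (C.label∈ t i))

contains-cycle : ∀ {s N n} (C : RGraph (2 + s) (suc s * suc N)) {e : Fin (suc N) → Subset (suc s * suc N)} →
                 edges C ↭ tabulate e → LinearCycle (2 + s) e → (G : RGraph (2 + s) n) {f : Fin (suc N) → Subset n} →
                 LinearCycle (2 + s) f → (∀ i → f i ∈ˡ edges G) → Contains G C
contains-cycle C {e} edges↭e cycle G {f} D f∈G = E.φ , E.φ-injective , edges→
  where
  module E = Embedding cycle D
  edges→ : ∀ p → p ∈ˡ edges C → image E.φ p ∈ˡ edges G
  edges→ p p∈ with ∈-tabulate⁻ {f = e} (∈-resp-↭ edges↭e p∈)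
  ... | i , refl = subst (_∈ˡ edges G) (sym (E.image-edge i)) (f∈G i)

-- Cyclic order and the shared vertices of a linear cycle

Next-cpred : ∀ {N} (j : Fin (suc N)) → Next (cpred j) j
Next-cpred {N} zero    = subst (λ i → suc N ∣ suc i) (sym (Finₚ.toℕ-fromℕ N)) ∣-refl
Next-cpred {N} (suc j) = subst (suc N ∣_) (sym (m≡n⇒∣m-n∣≡0 (Finₚ.toℕ-inject₁ j))) (suc N ∣0)

-- Size decides which multiple of `N + 1` occurs: for `j = zero` the difference is positive and at
-- most `N + 1`, otherwise it is at most `N` and must vanish.
Next⇒cpred : ∀ {N} (i j : Fin (suc N)) → Next i j → i ≡ cpred j
Next⇒cpred {N} i zero    next = Finₚ.toℕ-injective (trans (≤-antisym (Finₚ.toℕ≤pred[n] i) (s≤s⁻¹ (∣⇒≤ next))) (sym (Finₚ.toℕ-fromℕ N)))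
Next⇒cpred {N} i (suc j) next with ℕ.∣ toℕ i - toℕ j ∣ in eq
... | zero  = Finₚ.toℕ-injective (trans (∣m-n∣≡0⇒m≡n eq) (sym (Finₚ.toℕ-inject₁ j)))
... | suc d = ⊥-elim (<⇒≱ (s≤s (begin
  suc d                  ≡⟨ eq ⟨
  ℕ.∣ toℕ i - toℕ j ∣    ≤⟨ ∣m-n∣≤m⊔n (toℕ i) (toℕ j) ⟩
  toℕ i ⊔ toℕ j          ≤⟨ ⊔-lub (Finₚ.toℕ≤pred[n] i) (≤-trans (n≤1+n _) (Finₚ.toℕ≤pred[n] (suc j))) ⟩
  N                      ∎)) (∣⇒≤ next))
  where open ≤-Reasoning

-- Length at least four keeps an index and its first three predecessors distinct; this and the next
-- two lemmas certify that certain edges are not consecutive.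
cpred≢ : ∀ {N} (j : Fin (4 + N)) → j ≢ cpred j
cpred≢ zero          ()
cpred≢ (suc j) eq = 1+n≢n (trans (cong toℕ eq) (Finₚ.toℕ-inject₁ j))

cpred²≢ : ∀ {N} (j : Fin (4 + N)) → j ≢ cpred (cpred j)
cpred²≢ zero       ()
cpred²≢ (suc zero) ()
cpred²≢ (suc (suc j)) eq = m+1+n≢m _ {1} (trans (+-comm (toℕ j) 2) (trans (cong toℕ eq)
  (trans (Finₚ.toℕ-inject₁ (inject₁ j)) (Finₚ.toℕ-inject₁ j))))

cpred³≢ : ∀ {N} (j : Fin (4 + N)) → j ≢ cpred (cpred (cpred j))
cpred³≢ zero             ()
cpred³≢ (suc zero)       ()
cpred³≢ (suc (suc zero)) ()
cpred³≢ (suc (suc (suc j))) eq = m+1+n≢m _ {2} (trans (+-comm (toℕ j) 3) (trans (cong toℕ eq)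
  (trans (Finₚ.toℕ-inject₁ (inject₁ (inject₁ j))) (trans (Finₚ.toℕ-inject₁ (inject₁ j)) (Finₚ.toℕ-inject₁ j)))))

-- Take `x i` to be the common vertex of the edges `i` and `i + 1`. If it equalled `x (i - 1)`, it
-- would lie in the edges `i - 1` and `i + 1`, which are disjoint when the length is at least four.
-- A second common vertex of consecutive edges would make their intersection too large.
isLinearCycle⇒LinearCycle : ∀ {r N} (C : RGraph r ((r ∸ 1) * (4 + N))) (cyc : IsLinearCycle r (4 + N) C) →
                            LinearCycle r (proj₁ cyc)
isLinearCycle⇒LinearCycle {r} {N} C (e , edges↭e , adjacent , apart) = record
  { card     = λ i → All.lookup (uniform C) (∈-resp-↭ (↭-sym edges↭e) (∈-tabulate⁺ {f = e} i))
  ; x        = x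
  ; x∈       = x∈
  ; x-pred∈  = x-pred∈
  ; x≢       = x≢
  ; disjoint = disjoint
  }
  where
  csuc : Fin (4 + N) → Fin (4 + N)
  csuc i = proj₁ (cpred-surjective i)
  cpred-csuc : ∀ i → cpred (csuc i) ≡ i
  cpred-csuc i = proj₂ (cpred-surjective i)
  meet : ∀ i → ∃[ y ] y ∈ e (cpred i) ∩ e i
  meet i with sum-positive (χ (e (cpred i) ∩ e i))
                (subst (0 <_) (sym (trans (sum-χ (e (cpred i) ∩ e i))
                  (adjacent (cpred i) i (cpred≢ i ∘ sym) (inj₁ (Next-cpred i))))) z<s)
  ... | y , pos = y , χ-positive (e (cpred i) ∩ e i) y pos
  x : Fin (4 + N) → Fin _
  x i = proj₁ (meet (csuc i))
  in-both : ∀ i → x i ∈ e i × x i ∈ e (csuc i)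
  in-both i with x∈p∩q⁻ (e (cpred (csuc i))) (e (csuc i)) (proj₂ (meet (csuc i)))
  ... | x∈p , x∈c = subst (λ j → x i ∈ e j) (cpred-csuc i) x∈p , x∈c
  x∈ : ∀ i → x i ∈ e i
  x∈ i = proj₁ (in-both i)
  x-pred∈ : ∀ i → x (cpred i) ∈ e i
  x-pred∈ i = subst (λ j → x (cpred i) ∈ e j) (cpred-injective (cpred-csuc (cpred i))) (proj₂ (in-both (cpred i)))
  separate : ∀ {i j y} → i ≢ j → ¬ (Next i j ⊎ Next j i) → y ∈ e i → y ∈ e j → ⊥
  separate {i} {j} i≢j ¬next y∈i y∈j =
    n≮0 (subst (0 <_) (trans (card-remove (x∈p∩q⁺ (y∈i , y∈j))) (apart i j i≢j ¬next)) z<s)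
  x≢ : ∀ i → x i ≢ x (cpred i)
  x≢ i eq = separate (λ same → cpred²≢ (csuc i) (trans same (cong cpred i≡))) ¬next
              (proj₂ (in-both i)) (subst (_∈ e (cpred i)) (sym eq) (x∈ (cpred i)))
    where
    i≡ : i ≡ cpred (csuc i)
    i≡ = sym (cpred-csuc i)
    ¬next : ¬ (Next (csuc i) (cpred i) ⊎ Next (cpred i) (csuc i))
    ¬next (inj₁ next) = cpred³≢ (csuc i) (trans (Next⇒cpred (csuc i) (cpred i) next) (cong (cpred ∘ cpred) i≡))
    ¬next (inj₂ next) = cpred≢ i (trans i≡ (sym (Next⇒cpred (cpred i) (csuc i) next)))
  consecutive : ∀ {i j y} → i ≡ cpred j → y ∈ e i → y ≢ x i → y ∈ e j → ⊥
  consecutive {j = j} refl y∈i y≢x y∈j =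
    <⇒≢ (two≤card (x∈p∩q⁺ (y∈i , y∈j)) (x∈p∩q⁺ (x∈ (cpred j) , x-pred∈ j)) y≢x)
        (sym (adjacent (cpred j) j (cpred≢ j ∘ sym) (inj₁ (Next-cpred j))))
  disjoint : ∀ {i j y} → i ≢ j → y ∈ e i → y ≢ x i → y ∈ e j → y ≢ x j → ⊥
  disjoint {i} {j} i≢j y∈i y≢i y∈j y≢j with i Finₚ.≟ cpred j | j Finₚ.≟ cpred i
  ... | yes i≡ | _      = consecutive i≡ y∈i y≢i y∈j
  ... | no  _  | yes j≡ = consecutive j≡ y∈j y≢j y∈i
  ... | no  i≢ | no  j≢ = separate i≢j [ i≢ ∘ Next⇒cpred i j , j≢ ∘ Next⇒cpred j i ]′ y∈i y∈j

-- Passing to large minimum degree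

module _ {n : ℕ} where

  degree : List (Subset n) → Fin n → ℕ
  degree es u = sum λ i → χ (List.lookup es i) u

  delete : Fin n → List (Subset n) → List (Subset n)
  delete u = filter (λ e → ¬? (u ∈? e))

  χ-∉ : ∀ {p : Subset n} {x} → ¬ x ∈ p → χ p x ≡ 0
  χ-∉ {p} {x} x∉p with χ p x in eq
  ... | zero  = refl
  ... | suc _ = ⊥-elim (x∉p (χ-positive p x (subst (0 <_) (sym eq) z<s)))

  length-delete : ∀ u es → length (delete u es) + degree es u ≡ length es
  length-delete u []       = refl
  length-delete u (e ∷ es) with u ∈? e
  ... | yes u∈e = trans (cong (λ x → length (delete u es) + (x + degree es u)) (χ-∈ u∈e))
                    (trans (+-suc _ _) (cong suc (length-delete u es)))
  ... | no  u∉e = cong suc (trans (cong (λ x → length (delete u es) + (x + degree es u)) (χ-∉ u∉e)) (length-delete u es))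

  degree-delete : ∀ u es → degree (delete u es) u ≡ 0
  degree-delete u []       = refl
  degree-delete u (e ∷ es) with u ∈? e
  ... | yes _   = degree-delete u es
  ... | no  u∉e = cong₂ _+_ (χ-∉ u∉e) (degree-delete u es)

  degree-delete-≤ : ∀ u es v → degree (delete u es) v ≤ degree es v
  degree-delete-≤ u []       v = ≤-refl
  degree-delete-≤ u (e ∷ es) v with u ∈? e
  ... | yes _ = ≤-trans (degree-delete-≤ u es v) (m≤n+m _ (χ e v))
  ... | no  _ = +-monoʳ-≤ (χ e v) (degree-delete-≤ u es v)

  -- The number of non-isolated vertices. `core` measures density against it and not against `n`,
  -- because it drops with every deletion and so pays for the `t` edges lost.
  support : List (Subset n) → ℕ
  support es = sum λ u → 1 ⊓ degree es u

  support≤n : ∀ es → support es ≤ n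
  support≤n es = ≤-trans (sum-mono λ u → m⊓n≤m 1 (degree es u)) (≤-reflexive (sum-one n))

  support-delete : ∀ u es → 0 < degree es u → support (delete u es) < support es
  support-delete u es pos = begin
    suc (support (delete u es))                                  ≡⟨ +-comm 1 _ ⟩
    support (delete u es) + 1                                    ≡⟨ cong (support (delete u es) +_) (sum-one-δ) ⟨
    support (delete u es) + sum (λ v → δ v u)                    ≡⟨ ∑-distrib-+ (λ v → 1 ⊓ degree (delete u es) v) (λ v → δ v u) ⟨
    sum (λ v → 1 ⊓ degree (delete u es) v + δ v u)               ≤⟨ sum-mono drop ⟩
    support es                                                   ∎
    where
    open ≤-Reasoning
    sum-one-δ : sum (λ v → δ v u) ≡ 1
    sum-one-δ = trans (sum-cong-≗ λ v → sym (*-identityʳ (δ v u))) (sum-δ u λ _ → 1)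
    drop : ∀ v → 1 ⊓ degree (delete u es) v + δ v u ≤ 1 ⊓ degree es v
    drop v with v Finₚ.≟ u
    ... | yes refl = subst (λ d → 1 ⊓ d + 1 ≤ 1 ⊓ degree es u) (sym (degree-delete u es)) (⊓-glb ≤-refl pos)
    ... | no  _    = ≤-trans (≤-reflexive (+-identityʳ _)) (⊓-monoʳ-≤ 1 (degree-delete-≤ u es v))

  record Core (t : ℕ) (es : List (Subset n)) : Set where
    field
      core       : List (Subset n)
      core⊆      : ∀ {e} → e ∈ˡ core → e ∈ˡ es
      core!      : Unique core
      nonempty   : 0 < length core
      min-degree : ∀ u → degree core u ≡ 0 ⊎ t < degree core u

  -- Deleting a vertex of degree at most t preserves t * support es < length es.
  core : ∀ t fuel es → length es ≤ fuel → Unique es → t * support es < length es → Core t es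
  core t zero       es es≤ es! dense = ⊥-elim (n≮0 (≤-trans dense es≤))
  core t (suc fuel) es es≤ es! dense with Finₚ.any? (λ u → (0 <? degree es u) ×-dec (degree es u ≤? t))
  ... | no all-large = record
    { core = es ; core⊆ = λ e∈ → e∈ ; core! = es! ; nonempty = ≤-trans (s≤s z≤n) dense ; min-degree = large }
    where
    large : ∀ u → degree es u ≡ 0 ⊎ t < degree es u
    large u with degree es u in eq
    ... | zero  = inj₁ refl
    ... | suc d = inj₂ (≰⇒> λ d≤t → all-large (u , subst (0 <_) (sym eq) z<s , subst (_≤ t) (sym eq) d≤t))
  ... | yes (u , pos , small) = record
    { core = K.core ; core⊆ = proj₁ ∘ ∈-filter⁻ (λ e → ¬? (u ∈? e)) ∘ K.core⊆
    ; core! = K.core! ; nonempty = K.nonempty ; min-degree = K.min-degree }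
    where
    open ≤-Reasoning
    dense′ : t * support (delete u es) < length (delete u es)
    dense′ = +-cancelʳ-< t _ _ (begin-strict
      t * support (delete u es) + t       ≡⟨ trans (+-comm _ t) (sym (*-suc t _)) ⟩
      t * suc (support (delete u es))     ≤⟨ *-monoʳ-≤ t (support-delete u es pos) ⟩
      t * support es                      <⟨ dense ⟩
      length es                           ≡⟨ length-delete u es ⟨
      length (delete u es) + degree es u  ≤⟨ +-monoʳ-≤ (length (delete u es)) small ⟩
      length (delete u es) + t            ∎)
    shorter : length (delete u es) ≤ fuel
    shorter = s≤s⁻¹ (begin
      suc (length (delete u es))            ≡⟨ +-comm 1 _ ⟩
      length (delete u es) + 1              ≤⟨ +-monoʳ-≤ (length (delete u es)) pos ⟩
      length (delete u es) + degree es u    ≡⟨ length-delete u es ⟩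
      length es                             ≤⟨ es≤ ⟩
      suc fuel                              ∎)
    module K = Core (core t fuel (delete u es) shorter (filter⁺ (λ e → ¬? (u ∈? e)) es!) dense′)

-- From minimum degree back to the number of edges

lookup-unique : ∀ {X : Set} {xs : List X} → Unique xs → ∀ i j → List.lookup xs i ≡ List.lookup xs j → i ≡ j
lookup-unique {xs = _ ∷ xs} (_ ∷ _) zero    zero    eq = refl
lookup-unique {xs = _ ∷ xs} (x∉ ∷ _) zero    (suc j) eq = ⊥-elim (All.lookup x∉ (∈-lookup {xs = xs} j) eq)
lookup-unique {xs = _ ∷ xs} (x∉ ∷ _) (suc i) zero    eq = ⊥-elim (All.lookup x∉ (∈-lookup {xs = xs} i) (sym eq))
lookup-unique {xs = _ ∷ xs} (_ ∷ u) (suc i) (suc j) eq = cong suc (lookup-unique u i j eq)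

module _ {s m : ℕ} (C : RGraph (2 + s) (suc s * (4 + (m + m)))) (cyc : IsLinearCycle (2 + s) (4 + (m + m)) C)
         {n : ℕ} .{{_ : NonZero n}} (G : RGraph (2 + s) n) (linear : Linear G) (free : ¬ Contains G C) where

  -- Of the `k + 1` factors `n`, averaging the edges over the vertices gives `k`, and the trace at
  -- length zero gives the last one.
  sparse : ∀ p → size G ≡ suc p → suc p ^ (2 + m)
                 ≤ ((3 + (m + m)) * (3 + (m + m)) * (4 * ((2 + s) * (2 + s)))) ^ (2 + m) * n ^ ((2 + m) + 1)
  sparse p size≡ = begin
    suc p ^ k                  ≤⟨ ^-monoˡ-≤ k average ⟩
    (suc t * n) ^ k            ≡⟨ ^-distribʳ-* k (suc t) n ⟩
    suc t ^ k * n ^ k          ≤⟨ *-monoˡ-≤ (n ^ k) (Shadow.cycle-free-bound (2 + s) e (λ i → All.lookup (uniform G) (e∈G i)) meets-once (s≤s (s≤s z≤n)) (suc t) K.min-degree m K.nonempty no-cycle) ⟩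
    X ^ k * n * n ^ k          ≡⟨ *-assoc (X ^ k) n (n ^ k) ⟩
    X ^ k * n ^ suc k          ≡⟨ cong (λ l → X ^ k * n ^ l) (+-comm 1 k) ⟩
    X ^ k * n ^ (k + 1)        ∎
    where
    open ≤-Reasoning
    k = 2 + m
    -- For `suc p` edges, `suc (p / n)` is the average rounded up: `t * n ≤ p` leaves the strict
    -- inequality that `core` needs, and `suc p ≤ suc t * n` recovers the edge count.
    t = p / n
    X = (3 + (m + m)) * (3 + (m + m)) * (4 * ((2 + s) * (2 + s)))
    average : suc p ≤ suc t * n
    average = subst (_< suc t * n) (sym (m≡m%n+[m/n]*n p n)) (+-monoˡ-< (t * n) (m%n<n p n))
    dense : t * support (edges G) < length (edges G)
    dense = begin-strict
      t * support (edges G)   ≤⟨ *-monoʳ-≤ t (support≤n (edges G)) ⟩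
      t * n                   ≤⟨ m/n*n≤m p n ⟩
      p                       <⟨ n<1+n p ⟩
      suc p                   ≡⟨ size≡ ⟨
      length (edges G)        ∎
    module K = Core (core t (length (edges G)) (edges G) ≤-refl (unique G) dense)
    e : Fin (length K.core) → Subset n
    e = List.lookup K.core
    e∈G : ∀ i → e i ∈ˡ edges G
    e∈G i = K.core⊆ (∈-lookup i)
    meets-once : ∀ i j {u v} → i ≢ j → u ∈ e i → v ∈ e i → u ∈ e j → v ∈ e j → u ≡ v
    meets-once i j {u} {v} i≢j u∈i v∈i u∈j v∈j with u Finₚ.≟ v
    ... | yes u≡v = u≡v
    ... | no  u≢v = ⊥-elim (<⇒≱ (two≤card (x∈p∩q⁺ (u∈i , u∈j)) (x∈p∩q⁺ (v∈i , v∈j)) u≢v)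
                      (linear (e i) (e j) (e∈G i) (e∈G j) (i≢j ∘ lookup-unique K.core! i j)))
    no-cycle : ¬ Σ (Fin (4 + (m + m)) → Fin (length K.core)) λ ι → LinearCycle (2 + s) (e ∘ ι)
    no-cycle (ι , D) = free (contains-cycle C (proj₁ (proj₂ cyc)) (isLinearCycle⇒LinearCycle C cyc) G D (e∈G ∘ ι))

-- With `k = 2 + m` the argument yields `(2k - 1)² * 4r²`, hence `16 k² r²`; the stated constant is
-- larger because 16 ≤ 64 and `2 ≤ 2 * r + 3`.
constant≤ : ∀ m r .{{_ : NonZero r}} →
            (3 + (m + m)) * (3 + (m + m)) * (4 * (r * r)) ≤ 64 * (2 + m) ^ 2 * r ^ (2 * r + 3)
constant≤ m r = begin
  (3 + (m + m)) * (3 + (m + m)) * (4 * (r * r))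
    ≤⟨ *-monoˡ-≤ (4 * (r * r)) (*-mono-≤ (n≤1+n (3 + (m + m))) (n≤1+n (3 + (m + m)))) ⟩
  (4 + (m + m)) * (4 + (m + m)) * (4 * (r * r))
    ≡⟨ rearrange m r ⟩
  16 * ((2 + m) * ((2 + m) * 1)) * (r * (r * 1))
    ≤⟨ *-mono-≤ (*-monoˡ-≤ ((2 + m) ^ 2) (m≤m+n 16 48)) (^-monoʳ-≤ r (≤-trans (n≤1+n 2) (m≤n+m 3 (2 * r)))) ⟩
  64 * (2 + m) ^ 2 * r ^ (2 * r + 3) ∎
  where
  open ≤-Reasoning
  rearrange : ∀ m r → (4 + (m + m)) * (4 + (m + m)) * (4 * (r * r)) ≡ 16 * ((2 + m) * ((2 + m) * 1)) * (r * (r * 1))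
  rearrange = solve-∀

corollary1p4 : ∀ (r k : ℕ) → 3 ≤ r → 2 ≤ k →
    ∀ (C : RGraph r ((r ∸ 1) * (2 * k))) → IsLinearCycle r (2 * k) C →
    ∀ (n : ℕ) → 1 ≤ n →
    ∀ (ex : ℕ) → IsExL n C ex →
    -- ex ≤ 64 k² r^(2r+3) n^(1+1/k), raised to the k-th power
    ex ^ k ≤ (64 * k ^ 2 * r ^ (2 * r + 3)) ^ k * n ^ (k + 1)
corollary1p4 r k (s≤s (s≤s {n = s} _)) (s≤s (s≤s {n = m} z≤n)) C cyc n 1≤n ex ((G , linear , free , size≡) , _) =
  bound ex size≡ (2 * k) (even m) C cyc free
  where
  even : ∀ m → 2 * (2 + m) ≡ 4 + (m + m)
  even = solve-∀
  -- The length `2 * k` occurs in the type of `C`; making it a variable lets `refl` replace it by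
  -- `4 + (m + m)`.
  bound : ∀ ex → size G ≡ ex → ∀ ℓ → ℓ ≡ 4 + (m + m) → (C : RGraph r ((r ∸ 1) * ℓ)) → IsLinearCycle r ℓ C →
          ¬ Contains G C → ex ^ k ≤ (64 * k ^ 2 * r ^ (2 * r + 3)) ^ k * n ^ (k + 1)
  -- `sparse` takes the edge count as a successor, so an extremal graph without edges is settled
  -- separately.
  bound zero    _     _ _    _ _   _    = z≤n
  bound (suc p) size≡ _ refl C cyc free = ≤-trans
    (sparse {s} {m} C cyc {{>-nonZero 1≤n}} G linear free p size≡)
    (*-monoˡ-≤ (n ^ (k + 1)) (^-monoˡ-≤ k (constant≤ m r)))
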